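{- Let $\alpha>0$. For every weighted multigraph $G$ and every $i,j\in V(G)$, $$\widetilde{\rho}_{ij}(G')=2d^{\alpha}_{ij}(G),$$ where $G'$ is the $\alpha$-extension of $G$, $\widetilde{\rho}_{ij}(G')$ is the resistance distance on $G'$, and $d^{\alpha}_{ij}(G)$ is the forest distance on $G$ with parameter $\alpha$.
   Context: A weighted multigraph $G$ has finite vertex set $V(G)=\{1,\ldots,n\}$; multiple edges are allowed, loops are not, and all edge weights are strictly positive. Its Laplacian matrix $L=L(G)=(\ell_{ij})$ is given by: for $j\ne i$, $\ell_{ij}$ is minus the sum of the weights of all edges with terminal vertices $i$ and $j$; and $\ell_{ii}=-\sum_{j\neq i}\ell_{ij}$. For a parameter $\alpha>0$, the relative forest accessibility matrix is $Q_\alpha=(q^{\alpha}_{ij})=(I+\alpha L)^{ -1}$, and the forest distance on $G$ is $d^{\alpha}_{ij}(G)=\frac12(q^{\alpha}_{ii}+q^{\alpha}_{jj}-q^{\alpha}_{ij}-q^{\alpha}_{ji})$. The resistance distance on a weighted multigraph $H$ with Laplacian matrix $L(H)$ (defined analogously on its vertex set) takes values in $\mathbb{R}\cup\{+\infty\}$: if $i$ and $j$ belong to different components of $H$, then $\widetilde{\rho}_{ij}(H)=+\infty$; otherwise $\widetilde{\rho}_{ij}(H)=\ell^{+}_{ii}+\ell^{+}_{jj}-\ell^{+}_{ij}-\ell^{+}_{ji}$, where $\ell^{+}_{ij}$ are the entries of the Moore--Penrose generalized inverse of $L(H)$. The $\alpha$-extension of $G$ is the weighted multigraph $G'$ such that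 (i) $V(G')=V(G)\cup\{0\}$, where $0$ is a new vertex; (ii) the restriction of the edge set $E(G')$ to $V(G)$ coincides with $E(G)$, and the weight of each such edge in $G'$ is $\alpha$ times its weight in $G$; (iii) $E(G')$ contains one edge $(0,i)$ of weight $1$ for each vertex $i\in V(G)$ (and no other edges). -}

module Defs where

open import Algebra.Apartness.Structures using (IsHeytingField)
open import Algebra.Bundles using (CommutativeRing)
open import Algebra.Core using (Op₁; Op₂)
import Algebra.Properties.Ring as RingProperties
import Algebra.Properties.Semiring.Sum as SemiringSum
import Algebra.Solver.Ring.NaturalCoefficients.Default as NatSolver
open import Data.Bool.Base using (if_then_else_)
open import Data.Fin.Base using (Fin; zero; suc)
open import Data.Fin.Properties using (_≟_; suc-injective)
open import Data.List.Base using (List; []; _∷_; _++_; map; filter; foldr; tabulate)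
open import Data.List.Properties using (filter-accept; filter-reject)
open import Data.List.Relation.Unary.All as All using (All; []; _∷_)
open import Data.List.Relation.Unary.Any as Any using (Any; here; there)
open import Data.Nat.Base using (ℕ; zero; suc)
open import Data.Product.Base using (∃; ∃-syntax; _×_; _,_; proj₁; proj₂)
open import Data.Sum.Base using (_⊎_; inj₁; inj₂)
open import Function.Base using (_∘_)
open import Level using (_⊔_) renaming (suc to ℓsuc)
open import Relation.Binary.Construct.Closure.ReflexiveTransitive as Star using (Star; ε; _◅_; _◅◅_)
open import Relation.Binary.Core using (Rel)
open import Relation.Binary.Definitions using (Decidable)
import Relation.Binary.Reasoning.Setoid as SetoidReasoning
open import Relation.Binary.PropositionalEquality.Core as ≡ using (_≡_; _≢_)
open import Relation.Binary.Structures using (IsStrictPartialOrder)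
open import Relation.Nullary.Decidable.Core using (Dec; yes; no; does; map′; _×-dec_; _⊎-dec_)
open import Relation.Nullary.Negation.Core using (¬_; contradiction)
open import Relation.Nullary.Construct.Add.Supremum using (_⁺; [_]; ⊤⁺)

-- Ordered fields in the constructive sense: apartness is "x < y or y < x".
-- No decidability of _<_ or _≈_ is assumed, so both the classical real
-- numbers and the Cauchy or Dedekind reals of constructive mathematics are
-- instances; completeness plays no role below and is not required.

record OrderedField c ℓ₁ ℓ₂ : Set (ℓsuc (c ⊔ ℓ₁ ⊔ ℓ₂)) where
  infix  8 -_
  infixl 7 _*_
  infixl 6 _+_
  infix  4 _≈_ _<_ _#_
  field
    Carrier : Set c
    _≈_     : Rel Carrier ℓ₁
    _<_     : Rel Carrier ℓ₂
    _+_ _*_ : Op₂ Carrier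
    -_      : Op₁ Carrier
    0# 1#   : Carrier

  _#_ : Rel Carrier ℓ₂
  x # y = x < y ⊎ y < x

  field
    isHeytingField       : IsHeytingField _≈_ _#_ _+_ _*_ -_ 0# 1#
    isStrictPartialOrder : IsStrictPartialOrder _≈_ _<_
    +-monoʳ-<            : ∀ x {y z} → y < z → x + y < x + z
    *-positive           : ∀ {x y} → 0# < x → 0# < y → 0# < x * y

  open IsHeytingField isHeytingField public
    using (isCommutativeRing; #-cotrans; #⇒invertible; invertible⇒#; tight)
  open IsStrictPartialOrder isStrictPartialOrder public
    using (<-respʳ-≈; <-respˡ-≈)
    renaming (irrefl to <-irrefl; trans to <-trans)

  commutativeRing : CommutativeRing c ℓ₁
  commutativeRing = record { isCommutativeRing = isCommutativeRing }

  open CommutativeRing commutativeRing public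
    hiding (Carrier; _≈_; _+_; _*_; -_; 0#; 1#; isCommutativeRing)
    renaming (zero to *-zero)

------------------------------------------------------------------------

module OrderedFieldProperties {c ℓ₁ ℓ₂} (F : OrderedField c ℓ₁ ℓ₂) where

  open OrderedField F
  open RingProperties ring
  open SemiringSum semiring using (sum)

  <-asym : ∀ {x y} → x < y → ¬ (y < x)
  <-asym p q = <-irrefl refl (<-trans p q)

  <-cotrans : ∀ {x y} → x < y → ∀ z → x < z ⊎ z < y
  <-cotrans p z with #-cotrans (inj₁ p) z
  ... | inj₁ (inj₁ x<z) = inj₁ x<z
  ... | inj₁ (inj₂ z<x) = inj₂ (<-trans z<x p)
  ... | inj₂ (inj₁ z<y) = inj₂ z<y
  ... | inj₂ (inj₂ y<z) = inj₁ (<-trans p y<z)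

  x-0≈x : ∀ x → x - 0# ≈ x
  x-0≈x x = trans (+-congˡ -0#≈0#) (+-identityʳ x)

  +-cancelˡ-< : ∀ x {y z} → x + y < x + z → y < z
  +-cancelˡ-< x p = <-respʳ-≈ (strip x _) (<-respˡ-≈ (strip x _) (+-monoʳ-< (- x) p))
    where
    strip : ∀ x y → - x + (x + y) ≈ y
    strip x y = trans (sym (+-assoc _ _ _)) (trans (+-congʳ (-‿inverseˡ x)) (+-identityˡ y))

  neg-positive : ∀ {x} → x < 0# → 0# < - x
  neg-positive {x} p = <-respˡ-≈ (-‿inverseˡ x) (<-respʳ-≈ (+-identityʳ _) (+-monoʳ-< (- x) p))

  square-positive : ∀ {x} → x # 0# → 0# < x * x
  square-positive {x} (inj₁ x<0) =
    <-respʳ-≈ (trans (sym (-‿distribˡ-* x (- x)))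
              (trans (-‿cong (sym (-‿distribʳ-* x x))) (-‿involutive (x * x))))
              (*-positive (neg-positive x<0) (neg-positive x<0))
  square-positive (inj₂ 0<x) = *-positive 0<x 0<x

  inverse⇒#0 : ∀ {x y} → x * y ≈ 1# → x # 0#
  inverse⇒#0 {x} {y} xy≈1 = invertible⇒# (y , trans (*-comm _ _) eq , eq)
    where
    eq : (x - 0#) * y ≈ 1#
    eq = trans (*-congʳ (x-0≈x x)) xy≈1

  0<1 : 0# < 1#
  0<1 = <-respʳ-≈ (*-identityʳ 1#) (square-positive (inverse⇒#0 (*-identityʳ 1#)))

  factor-#0 : ∀ {x y} → (x * y) # 0# → y # 0#
  factor-#0 {x} {y} p with #⇒invertible p
  ... | z , _ , eq = inverse⇒#0
    (trans (sym (*-assoc _ _ _))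
    (trans (*-congʳ (trans (*-comm y x) (sym (x-0≈x _)))) eq))

  recip : ∀ x → 0# < x → Carrier
  recip x 0<x = proj₁ (#⇒invertible {x} {0#} (inj₂ 0<x))

  recip-inverse : ∀ x (0<x : 0# < x) → x * recip x 0<x ≈ 1#
  recip-inverse x 0<x =
    trans (*-congʳ (sym (x-0≈x x))) (proj₂ (proj₂ (#⇒invertible {x} {0#} (inj₂ 0<x))))

  NonNegative : Carrier → Set ℓ₂
  NonNegative x = ¬ (x < 0#)

  square-nonNegative : ∀ x → NonNegative (x * x)
  square-nonNegative x p = <-asym p (square-positive (factor-#0 (inj₁ p)))

  *-nonNegative : ∀ {x y} → 0# < x → NonNegative y → NonNegative (x * y)
  *-nonNegative 0<x y≥0 p with factor-#0 (inj₁ p)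
  ... | inj₁ y<0 = y≥0 y<0
  ... | inj₂ 0<y = <-asym p (*-positive 0<x 0<y)

  +-nonNegative : ∀ {x y} → NonNegative x → NonNegative y → NonNegative (x + y)
  +-nonNegative {x} x≥0 y≥0 p with <-cotrans p x
  ... | inj₁ x+y<x = y≥0 (+-cancelˡ-< x (<-respʳ-≈ (sym (+-identityʳ x)) x+y<x))
  ... | inj₂ x<0   = x≥0 x<0

  +-positive : ∀ {x y} → NonNegative x → 0# < y → 0# < x + y
  +-positive {x} {y} x≥0 0<y with <-cotrans 0<y (x + y)
  ... | inj₁ 0<x+y = 0<x+y
  ... | inj₂ x+y<y =
    contradiction (+-cancelˡ-< y (<-respʳ-≈ (sym (+-identityʳ y)) (<-respˡ-≈ (+-comm x y) x+y<y))) x≥0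

  positive⇒nonNegative : ∀ {x} → 0# < x → NonNegative x
  positive⇒nonNegative = <-asym

  sum-nonNegative : ∀ {n} (f : Fin n → Carrier) → (∀ k → NonNegative (f k)) → NonNegative (sum f)
  sum-nonNegative {zero}  f f≥0 = <-irrefl refl
  sum-nonNegative {suc n} f f≥0 = +-nonNegative (f≥0 zero) (sum-nonNegative (f ∘ suc) (f≥0 ∘ suc))

  sum-positive : ∀ {n} (f : Fin n → Carrier) → (∀ k → NonNegative (f k)) →
                 ∀ k → 0# < f k → 0# < sum f
  sum-positive f f≥0 zero    p =
    <-respʳ-≈ (+-comm _ _) (+-positive (sum-nonNegative (f ∘ suc) (f≥0 ∘ suc)) p)
  sum-positive f f≥0 (suc k) p = +-positive (f≥0 zero) (sum-positive (f ∘ suc) (f≥0 ∘ suc) k p)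

  sum-positive⁻¹ : ∀ {n} (f : Fin n → Carrier) → 0# < sum f → ∃[ k ] 0# < f k
  sum-positive⁻¹ {zero}  f p = contradiction p (<-irrefl refl)
  sum-positive⁻¹ {suc n} f p with <-cotrans p (f zero)
  ... | inj₁ q = zero , q
  ... | inj₂ q =
    let k , r = sum-positive⁻¹ (f ∘ suc) (+-cancelˡ-< (f zero) (<-respˡ-≈ (sym (+-identityʳ _)) q))
    in suc k , r

------------------------------------------------------------------------

module Matrices {c ℓ₁ ℓ₂} (F : OrderedField c ℓ₁ ℓ₂) where

  open OrderedField F
  open SemiringSum semiring using (sum-syntax)

  Matrix : ℕ → ℕ → Set c
  Matrix m n = Fin m → Fin n → Carrier

  infix  4 _≈ᴹ_
  infixl 6 _+ᴹ_
  infixl 7 _*ᴹ_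
  infixr 7 _•ᴹ_
  infix  8 _ᵀ

  _≈ᴹ_ : ∀ {m n} → Rel (Matrix m n) ℓ₁
  A ≈ᴹ B = ∀ i j → A i j ≈ B i j

  1ᴹ : ∀ {n} → Matrix n n
  1ᴹ i j = if does (i ≟ j) then 1# else 0#

  _+ᴹ_ : ∀ {m n} → Matrix m n → Matrix m n → Matrix m n
  (A +ᴹ B) i j = A i j + B i j

  _•ᴹ_ : ∀ {m n} → Carrier → Matrix m n → Matrix m n
  (x •ᴹ A) i j = x * A i j

  _*ᴹ_ : ∀ {m n p} → Matrix m n → Matrix n p → Matrix m p
  _*ᴹ_ {n = n} A B i j = ∑[ k < n ] (A i k * B k j)

  _ᵀ : ∀ {m n} → Matrix m n → Matrix n m
  (A ᵀ) i j = A j i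

  IsInverse : ∀ {n} → Matrix n n → Matrix n n → Set ℓ₁
  IsInverse A B = (A *ᴹ B ≈ᴹ 1ᴹ) × (B *ᴹ A ≈ᴹ 1ᴹ)

  record IsMoorePenroseInverse {m n} (A : Matrix m n) (A⁺ : Matrix n m) : Set ℓ₁ where
    field
      AA⁺A≈A     : A *ᴹ A⁺ *ᴹ A ≈ᴹ A
      A⁺AA⁺≈A⁺   : A⁺ *ᴹ A *ᴹ A⁺ ≈ᴹ A⁺
      AA⁺-sym    : (A *ᴹ A⁺) ᵀ ≈ᴹ A *ᴹ A⁺
      A⁺A-sym    : (A⁺ *ᴹ A) ᵀ ≈ᴹ A⁺ *ᴹ A

------------------------------------------------------------------------

module Multigraphs {c ℓ₁ ℓ₂} (F : OrderedField c ℓ₁ ℓ₂) where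

  open OrderedField F
  open SemiringSum semiring using (sum-syntax)
  open Matrices F

  record Edge (n : ℕ) : Set (c ⊔ ℓ₂) where
    field
      end₁ end₂ : Fin n
      loopless  : end₁ ≢ end₂
      weight    : Carrier
      positive  : 0# < weight

  open Edge public

  WeightedMultigraph : ℕ → Set (c ⊔ ℓ₂)
  WeightedMultigraph n = List (Edge n)

  Joins : ∀ {n} → Fin n → Fin n → Edge n → Set
  Joins i j e = (end₁ e ≡ i × end₂ e ≡ j) ⊎ (end₁ e ≡ j × end₂ e ≡ i)

  joins? : ∀ {n} (i j : Fin n) (e : Edge n) → Dec (Joins i j e)
  joins? i j e = (end₁ e ≟ i ×-dec end₂ e ≟ j) ⊎-dec (end₁ e ≟ j ×-dec end₂ e ≟ i)

  weightBetween : ∀ {n} → WeightedMultigraph n → Fin n → Fin n → Carrier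
  weightBetween G i j = foldr _+_ 0# (map weight (filter (joins? i j) G))

  laplacian : ∀ {n} → WeightedMultigraph n → Matrix n n
  laplacian {n} G i j = if does (i ≟ j) then - ∑[ k < n ] (if does (i ≟ k) then 0# else off i k) else off i j
    where
    off : Matrix n n
    off i j = - weightBetween G i j

  Adjacent : ∀ {n} → WeightedMultigraph n → Rel (Fin n) (c ⊔ ℓ₂)
  Adjacent G i j = Any (Joins i j) G

  Connected : ∀ {n} → WeightedMultigraph n → Rel (Fin n) (c ⊔ ℓ₂)
  Connected G = Star (Adjacent G)

  connected? : ∀ {n} (G : WeightedMultigraph n) → Decidable (Connected G)
  connected? []      i j = map′ (λ { ≡.refl → ε }) (λ { ε → ≡.refl ; (() ◅ _) }) (i ≟ j)
  connected? (e ∷ G) i j = map′ add split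
    (connected? G i j ⊎-dec
      ((connected? G i (end₁ e) ×-dec connected? G (end₂ e) j) ⊎-dec
       (connected? G i (end₂ e) ×-dec connected? G (end₁ e) j)))
    where
    Split : Rel _ _
    Split i j = Connected G i j ⊎
      ((Connected G i (end₁ e) × Connected G (end₂ e) j) ⊎
       (Connected G i (end₂ e) × Connected G (end₁ e) j))

    weaken : ∀ {i j} → Connected G i j → Connected (e ∷ G) i j
    weaken = Star.map there

    add : ∀ {i j} → Split i j → Connected (e ∷ G) i j
    add (inj₁ p)              = weaken p
    add (inj₂ (inj₁ (p , q))) = weaken p ◅◅ here (inj₁ (≡.refl , ≡.refl)) ◅ weaken q
    add (inj₂ (inj₂ (p , q))) = weaken p ◅◅ here (inj₂ (≡.refl , ≡.refl)) ◅ weaken q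

    cons : ∀ {i k j} → Adjacent (e ∷ G) i k → Split k j → Split i j
    cons (here (inj₁ (≡.refl , ≡.refl))) (inj₁ p)              = inj₂ (inj₁ (ε , p))
    cons (here (inj₁ (≡.refl , ≡.refl))) (inj₂ (inj₁ (_ , p))) = inj₂ (inj₁ (ε , p))
    cons (here (inj₁ (≡.refl , ≡.refl))) (inj₂ (inj₂ (_ , p))) = inj₁ p
    cons (here (inj₂ (≡.refl , ≡.refl))) (inj₁ p)              = inj₂ (inj₂ (ε , p))
    cons (here (inj₂ (≡.refl , ≡.refl))) (inj₂ (inj₁ (_ , p))) = inj₁ p
    cons (here (inj₂ (≡.refl , ≡.refl))) (inj₂ (inj₂ (_ , p))) = inj₂ (inj₂ (ε , p))
    cons (there a) (inj₁ p)              = inj₁ (a ◅ p)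
    cons (there a) (inj₂ (inj₁ (p , q))) = inj₂ (inj₁ (a ◅ p , q))
    cons (there a) (inj₂ (inj₂ (p , q))) = inj₂ (inj₂ (a ◅ p , q))

    split : ∀ {i j} → Connected (e ∷ G) i j → Split i j
    split ε       = inj₁ ε
    split (a ◅ p) = cons a (split p)

------------------------------------------------------------------------

module LinearAlgebra {c ℓ₁ ℓ₂} (F : OrderedField c ℓ₁ ℓ₂) where

  open OrderedField F
  open OrderedFieldProperties F
  open SemiringSum semiring
    using (sum; sum-cong-≋; sum-syntax; ∑-distrib-+; ∑-comm; *-distribˡ-sum; *-distribʳ-sum)
  open NatSolver commutativeSemiring using (solve; _:=_; _:+_; _:*_; con)
  open Matrices F
  open SetoidReasoning setoid

  Vec : ℕ → Set c
  Vec n = Fin n → Carrier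

  infix  4 _≋_
  infix  8 _·_
  infixr 7 _*ᵥ_

  _≋_ : ∀ {n} → Rel (Vec n) ℓ₁
  x ≋ y = ∀ i → x i ≈ y i

  _·_ : ∀ {n} → Vec n → Vec n → Carrier
  _·_ {n} x y = ∑[ k < n ] (x k * y k)

  _*ᵥ_ : ∀ {m n} → Matrix m n → Vec n → Vec m
  (A *ᵥ x) i = A i · x

  Symmetric : ∀ {n} → Matrix n n → Set ℓ₁
  Symmetric A = A ᵀ ≈ᴹ A

  ≋-trans : ∀ {n} {x y z : Vec n} → x ≋ y → y ≋ z → x ≋ z
  ≋-trans p q i = trans (p i) (q i)

  ≋-sym : ∀ {n} {x y : Vec n} → x ≋ y → y ≋ x
  ≋-sym p i = sym (p i)

  ·-cong : ∀ {n} {x x′ y y′ : Vec n} → x ≋ x′ → y ≋ y′ → x · y ≈ x′ · y′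
  ·-cong p q = sum-cong-≋ (λ k → *-cong (p k) (q k))

  ·-congˡ : ∀ {n} (x : Vec n) {y y′} → y ≋ y′ → x · y ≈ x · y′
  ·-congˡ x = ·-cong {x = x} (λ _ → refl)

  ·-congʳ : ∀ {n} {x x′ : Vec n} y → x ≋ x′ → x · y ≈ x′ · y
  ·-congʳ y p = ·-cong {y = y} p (λ _ → refl)

  ·-comm : ∀ {n} (x y : Vec n) → x · y ≈ y · x
  ·-comm x y = sum-cong-≋ (λ k → *-comm (x k) (y k))

  ·-linearʳ : ∀ {n} (x y : Vec n) a z → x · (λ k → y k + a * z k) ≈ x · y + a * (x · z)
  ·-linearʳ x y a z = begin
    sum (λ k → x k * (y k + a * z k))
      ≈⟨ sum-cong-≋ (λ k → solve 4 (λ x y a z → x :* (y :+ a :* z) := x :* y :+ a :* (x :* z)) refl (x k) (y k) a (z k)) ⟩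
    sum (λ k → x k * y k + a * (x k * z k))
      ≈⟨ ∑-distrib-+ (λ k → x k * y k) (λ k → a * (x k * z k)) ⟩
    x · y + sum (λ k → a * (x k * z k))
      ≈⟨ +-congˡ (*-distribˡ-sum a (λ k → x k * z k)) ⟨
    x · y + a * (x · z) ∎

  ·-linearˡ : ∀ {n} (x : Vec n) a y z → (λ k → x k + a * y k) · z ≈ x · z + a * (y · z)
  ·-linearˡ x a y z =
    trans (·-comm (λ k → x k + a * y k) z)
    (trans (·-linearʳ z x a y) (+-cong (·-comm z x) (*-congˡ (·-comm z y))))

  ·-zeroʳ : ∀ {n} (x : Vec n) {y} → (∀ k → y k ≈ 0#) → x · y ≈ 0#
  ·-zeroʳ {zero}  x p = refl
  ·-zeroʳ {suc n} x p =
    trans (+-cong (trans (*-congˡ (p zero)) (zeroʳ _)) (·-zeroʳ (x ∘ suc) (p ∘ suc))) (+-identityʳ 0#)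

  ·-scaleʳ : ∀ {n} (x : Vec n) a y → x · (λ k → a * y k) ≈ a * (x · y)
  ·-scaleʳ x a y = trans
    (sum-cong-≋ (λ k → solve 3 (λ x a y → x :* (a :* y) := a :* (x :* y)) refl (x k) a (y k)))
    (sym (*-distribˡ-sum a (λ k → x k * y k)))

  ·-1ᴹ : ∀ {n} (x : Vec n) j → x · 1ᴹ j ≈ x j
  ·-1ᴹ x zero = trans (+-cong (*-identityʳ _) (·-zeroʳ (x ∘ suc) (λ _ → refl))) (+-identityʳ _)
  ·-1ᴹ x (suc j) = trans (+-cong (zeroʳ _) (trans (·-congˡ (x ∘ suc) shift) (·-1ᴹ (x ∘ suc) j))) (+-identityˡ _)
    where
    shift : ∀ k → 1ᴹ (suc j) (suc k) ≈ 1ᴹ j k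
    shift k with j ≟ k
    ... | yes _ = refl
    ... | no  _ = refl

  1ᴹ-symmetric : ∀ {n} → Symmetric (1ᴹ {n})
  1ᴹ-symmetric i j with i ≟ j | j ≟ i
  ... | yes _ | yes _ = refl
  ... | yes p | no ¬q = contradiction (≡.sym p) ¬q
  ... | no ¬p | yes q = contradiction (≡.sym q) ¬p
  ... | no  _ | no  _ = refl

  1ᴹ-*ᵥ : ∀ {n} (x : Vec n) → 1ᴹ *ᵥ x ≋ x
  1ᴹ-*ᵥ x i = trans (·-comm (1ᴹ i) x) (·-1ᴹ x i)

  *ᵥ-linear : ∀ {m n} (A : Matrix m n) x a y →
              A *ᵥ (λ k → x k + a * y k) ≋ (λ i → (A *ᵥ x) i + a * (A *ᵥ y) i)
  *ᵥ-linear A x a y i = ·-linearʳ (A i) x a y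

  *ᵥ-congˡ : ∀ {m n} (A : Matrix m n) {x y} → x ≋ y → A *ᵥ x ≋ A *ᵥ y
  *ᵥ-congˡ A p i = ·-congˡ (A i) p

  *ᵥ-congʳ : ∀ {m n} {A B : Matrix m n} x → A ≈ᴹ B → A *ᵥ x ≋ B *ᵥ x
  *ᵥ-congʳ x p i = ·-congʳ x (p i)

  *ᴹ-*ᵥ : ∀ {m n p} (A : Matrix m n) (B : Matrix n p) x → (A *ᴹ B) *ᵥ x ≋ A *ᵥ (B *ᵥ x)
  *ᴹ-*ᵥ {n = n} {p} A B x i = begin
    sum (λ j → sum (λ k → A i k * B k j) * x j)
      ≈⟨ sum-cong-≋ (λ j → *-distribʳ-sum (x j) (λ k → A i k * B k j)) ⟩
    sum (λ j → sum (λ k → A i k * B k j * x j))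
      ≈⟨ ∑-comm (λ j k → A i k * B k j * x j) ⟩
    sum (λ k → sum (λ j → A i k * B k j * x j))
      ≈⟨ sum-cong-≋ (λ k → sum-cong-≋ (λ j → *-assoc (A i k) (B k j) (x j))) ⟩
    sum (λ k → sum (λ j → A i k * (B k j * x j)))
      ≈⟨ sum-cong-≋ (λ k → *-distribˡ-sum (A i k) (λ j → B k j * x j)) ⟨
    sum (λ k → A i k * sum (λ j → B k j * x j)) ∎

  *ᵥ-extensional : ∀ {m n} {A B : Matrix m n} → (∀ x → A *ᵥ x ≋ B *ᵥ x) → A ≈ᴹ B
  *ᵥ-extensional {A = A} {B} p i j = trans (sym (·-1ᴹ (A i) j)) (trans (p (1ᴹ j) i) (·-1ᴹ (B i) j))

  selfAdjoint : ∀ {n} {A : Matrix n n} → Symmetric A → ∀ x y → x · (A *ᵥ y) ≈ (A *ᵥ x) · y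
  selfAdjoint {A = A} A-sym x y = begin
    sum (λ i → x i * sum (λ k → A i k * y k))
      ≈⟨ sum-cong-≋ (λ i → *-distribˡ-sum (x i) (λ k → A i k * y k)) ⟩
    sum (λ i → sum (λ k → x i * (A i k * y k)))
      ≈⟨ ∑-comm (λ i k → x i * (A i k * y k)) ⟩
    sum (λ k → sum (λ i → x i * (A i k * y k)))
      ≈⟨ sum-cong-≋ (λ k → sum-cong-≋ (λ i → trans (*-congˡ (*-congʳ (A-sym k i)))
           (solve 3 (λ x a y → x :* (a :* y) := a :* x :* y) refl (x i) (A k i) (y k)))) ⟩
    sum (λ k → sum (λ i → A k i * x i * y k))
      ≈⟨ sum-cong-≋ (λ k → *-distribʳ-sum (y k) (λ i → A k i * x i)) ⟨
    sum (λ k → sum (λ i → A k i * x i) * y k) ∎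

  -- A + a u vᵀ
  rankOne : ∀ {n} → Matrix n n → Carrier → Vec n → Vec n → Matrix n n
  rankOne A a u v i j = A i j + a * (u i * v j)

  rankOne-*ᵥ : ∀ {n} (A : Matrix n n) a u v x →
               rankOne A a u v *ᵥ x ≋ (λ i → (A *ᵥ x) i + a * (v · x) * u i)
  rankOne-*ᵥ A a u v x i = begin
    rankOne A a u v i · x
      ≈⟨ ·-congʳ x (λ j → +-congˡ (sym (*-assoc a (u i) (v j)))) ⟩
    (λ j → A i j + a * u i * v j) · x
      ≈⟨ ·-linearˡ (A i) (a * u i) v x ⟩
    (A *ᵥ x) i + a * u i * (v · x)
      ≈⟨ +-congˡ (solve 3 (λ a u q → a :* u :* q := a :* q :* u) refl a (u i) (v · x)) ⟩
    (A *ᵥ x) i + a * (v · x) * u i ∎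

  rankOne-symmetric : ∀ {n} {A : Matrix n n} a u → Symmetric A → Symmetric (rankOne A a u u)
  rankOne-symmetric a u A-sym i j = +-cong (A-sym i j) (*-congˡ (*-comm (u j) (u i)))

  PositiveSemidefinite : ∀ {n} → Matrix n n → Set (c ⊔ ℓ₂)
  PositiveSemidefinite A = ∀ x → NonNegative (x · (A *ᵥ x))

  rankOne-psd : ∀ {n} {A : Matrix n n} {a} u → 0# < a →
                PositiveSemidefinite A → PositiveSemidefinite (rankOne A a u u)
  rankOne-psd {A = A} {a} u 0<a A-psd x p =
    +-nonNegative (A-psd x) (*-nonNegative 0<a (square-nonNegative (u · x))) (<-respˡ-≈ eq p)
    where
    eq : x · (rankOne A a u u *ᵥ x) ≈ x · (A *ᵥ x) + a * ((u · x) * (u · x))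
    eq = begin
      x · (rankOne A a u u *ᵥ x)
        ≈⟨ ·-congˡ x (rankOne-*ᵥ A a u u x) ⟩
      x · (λ i → (A *ᵥ x) i + a * (u · x) * u i)
        ≈⟨ ·-linearʳ x (A *ᵥ x) (a * (u · x)) u ⟩
      x · (A *ᵥ x) + a * (u · x) * (x · u)
        ≈⟨ +-congˡ (trans (*-congˡ (·-comm x u)) (*-assoc _ _ _)) ⟩
      x · (A *ᵥ x) + a * ((u · x) * (u · x)) ∎

  -- The Penrose conditions for symmetric matrices, in terms of the action on vectors.

  record SymmetricPseudoinverse {n} (A P : Matrix n n) : Set (c ⊔ ℓ₁) where
    field
      A-sym   : Symmetric A
      P-sym   : Symmetric P
      commute : ∀ x → A *ᵥ (P *ᵥ x) ≋ P *ᵥ (A *ᵥ x)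
      APA     : ∀ x → A *ᵥ (P *ᵥ (A *ᵥ x)) ≋ A *ᵥ x
      PAP     : ∀ x → P *ᵥ (A *ᵥ (P *ᵥ x)) ≋ P *ᵥ x

    isMoorePenroseInverse : IsMoorePenroseInverse A P
    isMoorePenroseInverse = record
      { AA⁺A≈A   = *ᵥ-extensional (λ x → ≋-trans (*ᴹ-*ᵥ (A *ᴹ P) A x) (≋-trans (*ᴹ-*ᵥ A P (A *ᵥ x)) (APA x)))
      ; A⁺AA⁺≈A⁺ = *ᵥ-extensional (λ x → ≋-trans (*ᴹ-*ᵥ (P *ᴹ A) P x) (≋-trans (*ᴹ-*ᵥ P A (P *ᵥ x)) (PAP x)))
      ; AA⁺-sym  = λ i j → trans (transpose A-sym P-sym i j) (sym (AP≈PA i j))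
      ; A⁺A-sym  = λ i j → trans (transpose P-sym A-sym i j) (AP≈PA i j)
      }
      where
      AP≈PA : A *ᴹ P ≈ᴹ P *ᴹ A
      AP≈PA = *ᵥ-extensional (λ x → ≋-trans (*ᴹ-*ᵥ A P x) (≋-trans (commute x) (≋-sym (*ᴹ-*ᵥ P A x))))

      transpose : ∀ {M N : Matrix _ _} → Symmetric M → Symmetric N → (M *ᴹ N) ᵀ ≈ᴹ N *ᴹ M
      transpose M-sym N-sym i j =
        sum-cong-≋ (λ k → trans (*-cong (M-sym k j) (N-sym i k)) (*-comm _ _))

  0ᴹ-psd : ∀ {n} → PositiveSemidefinite {n} (λ _ _ → 0#)
  0ᴹ-psd x p = <-irrefl (·-zeroʳ x (λ i → trans (·-comm (λ _ → 0#) x) (·-zeroʳ x (λ _ → refl)))) p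

  1ᴹ-psd : ∀ {n} → PositiveSemidefinite {n} 1ᴹ
  1ᴹ-psd x p = sum-nonNegative (λ k → x k * x k) (λ k → square-nonNegative (x k))
    (<-respˡ-≈ (·-congˡ x (1ᴹ-*ᵥ x)) p)

  0ᴹ-pseudoinverse : ∀ {n} → SymmetricPseudoinverse {n} (λ _ _ → 0#) (λ _ _ → 0#)
  0ᴹ-pseudoinverse = record
    { A-sym   = λ _ _ → refl
    ; P-sym   = λ _ _ → refl
    ; commute = λ _ _ → refl
    ; APA     = λ x i → trans (zero-*ᵥ _ i) (sym (zero-*ᵥ x i))
    ; PAP     = λ x i → trans (zero-*ᵥ _ i) (sym (zero-*ᵥ x i))
    }
    where
    zero-*ᵥ : ∀ {n} (x : Vec n) → (λ _ _ → 0#) *ᵥ x ≋ (λ (_ : Fin n) → 0#)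
    zero-*ᵥ x i = trans (·-comm (λ _ → 0#) x) (·-zeroʳ x (λ _ → refl))

  1ᴹ-pseudoinverse : ∀ {n} → SymmetricPseudoinverse {n} 1ᴹ 1ᴹ
  1ᴹ-pseudoinverse = record
    { A-sym   = 1ᴹ-symmetric
    ; P-sym   = 1ᴹ-symmetric
    ; commute = λ _ _ → refl
    ; APA     = λ x → ≋-trans (1ᴹ-*ᵥ _) (1ᴹ-*ᵥ _)
    ; PAP     = λ x → ≋-trans (1ᴹ-*ᵥ _) (1ᴹ-*ᵥ _)
    }

  -- How a symmetric pseudoinverse P of A changes when w b bᵀ is added to A.

  module Update {n} {A P : Matrix n n} (isPinv : SymmetricPseudoinverse A P)
                (A-psd : PositiveSemidefinite A)
                (b : Vec n) {w} (0<w : 0# < w) where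

    open SymmetricPseudoinverse isPinv

    κ : Vec n
    κ = P *ᵥ b

    s : Carrier
    s = b · κ

    A′ : Matrix n n
    A′ = rankOne A w b b

    A′x : ∀ x → A′ *ᵥ x ≋ (λ i → (A *ᵥ x) i + w * (b · x) * b i)
    A′x = rankOne-*ᵥ A w b b

    s-nonNegative : NonNegative s
    s-nonNegative p = A-psd κ (<-respˡ-≈ (trans (·-congˡ b (≋-sym (PAP b))) (selfAdjoint P-sym b _)) p)

    0<1+ws : 0# < 1# + w * s
    0<1+ws = <-respʳ-≈ (+-comm _ _) (+-positive (*-nonNegative 0<w s-nonNegative) 0<1)

    bP≈κ : ∀ x → b · (P *ᵥ x) ≈ κ · x
    bP≈κ x = selfAdjoint P-sym b x

    -- b in the range of A (Sherman–Morrison)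
    module InRange (APb≈b : A *ᵥ κ ≋ b) where

      D⁻¹ : Carrier
      D⁻¹ = recip (1# + w * s) 0<1+ws

      a : Carrier
      a = (- w) * D⁻¹

      a-eq : w + a * (1# + w * s) ≈ 0#
      a-eq = begin
        w + (- w) * D⁻¹ * (1# + w * s)
          ≈⟨ +-congˡ (solve 3 (λ v d e → v :* d :* e := v :* (e :* d)) refl (- w) D⁻¹ (1# + w * s)) ⟩
        w + (- w) * ((1# + w * s) * D⁻¹)
          ≈⟨ +-congˡ (trans (*-congˡ (recip-inverse _ 0<1+ws)) (*-identityʳ _)) ⟩
        w + - w
          ≈⟨ -‿inverseʳ w ⟩
        0# ∎

      P′ : Matrix n n
      P′ = rankOne P a κ κ

      P′x : ∀ x → P′ *ᵥ x ≋ (λ i → (P *ᵥ x) i + a * (κ · x) * κ i)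
      P′x = rankOne-*ᵥ P a κ κ

      cancel : ∀ y q r → y + a * q * r + w * (q + a * q * s) * r ≈ y
      cancel y q r = begin
        y + a * q * r + w * (q + a * q * s) * r
          ≈⟨ solve 6 (λ y a q r w s → y :+ a :* q :* r :+ w :* (q :+ a :* q :* s) :* r
                       := y :+ (w :+ a :* (con 1 :+ w :* s)) :* (q :* r)) refl y a q r w s ⟩
        y + (w + a * (1# + w * s)) * (q * r)
          ≈⟨ +-congˡ (trans (*-congʳ a-eq) (zeroˡ _)) ⟩
        y + 0#
          ≈⟨ +-identityʳ y ⟩
        y ∎

      A′P′ : ∀ x → A′ *ᵥ (P′ *ᵥ x) ≋ A *ᵥ (P *ᵥ x)
      A′P′ x i = begin
        (A′ *ᵥ (P′ *ᵥ x)) i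
          ≈⟨ A′x (P′ *ᵥ x) i ⟩
        (A *ᵥ (P′ *ᵥ x)) i + w * (b · (P′ *ᵥ x)) * b i
          ≈⟨ +-cong
               (trans (*ᵥ-congˡ A (P′x x) i)
               (trans (*ᵥ-linear A (P *ᵥ x) (a * (κ · x)) κ i) (+-congˡ (*-congˡ (APb≈b i)))))
               (*-congʳ (*-congˡ
                 (trans (·-congˡ b (P′x x))
                 (trans (·-linearʳ b (P *ᵥ x) (a * (κ · x)) κ) (+-congʳ (bP≈κ x)))))) ⟩
        (A *ᵥ (P *ᵥ x)) i + a * (κ · x) * b i + w * (κ · x + a * (κ · x) * s) * b i
          ≈⟨ cancel _ _ _ ⟩
        (A *ᵥ (P *ᵥ x)) i ∎

      κA≈b : ∀ x → κ · (A *ᵥ x) ≈ b · x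
      κA≈b x = trans (selfAdjoint A-sym κ x) (·-congʳ x APb≈b)

      P′A′ : ∀ x → P′ *ᵥ (A′ *ᵥ x) ≋ P *ᵥ (A *ᵥ x)
      P′A′ x i = begin
        (P′ *ᵥ (A′ *ᵥ x)) i
          ≈⟨ P′x (A′ *ᵥ x) i ⟩
        (P *ᵥ (A′ *ᵥ x)) i + a * (κ · (A′ *ᵥ x)) * κ i
          ≈⟨ +-cong
               (trans (*ᵥ-congˡ P (A′x x) i) (*ᵥ-linear P (A *ᵥ x) (w * (b · x)) b i))
               (*-congʳ (*-congˡ
                 (trans (·-congˡ κ (A′x x))
                 (trans (·-linearʳ κ (A *ᵥ x) (w * (b · x)) b)
                        (+-cong (κA≈b x) (*-congˡ (·-comm κ b))))))) ⟩
        (P *ᵥ (A *ᵥ x)) i + w * (b · x) * κ i + a * (b · x + w * (b · x) * s) * κ i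
          ≈⟨ solve 6 (λ y a q r w s → y :+ w :* q :* r :+ a :* (q :+ w :* q :* s) :* r
                       := y :+ a :* q :* r :+ w :* (q :+ a :* q :* s) :* r) refl _ a (b · x) (κ i) w s ⟩
        (P *ᵥ (A *ᵥ x)) i + a * (b · x) * κ i + w * (b · x + a * (b · x) * s) * κ i
          ≈⟨ cancel _ _ _ ⟩
        (P *ᵥ (A *ᵥ x)) i ∎

      updated : SymmetricPseudoinverse A′ P′
      updated = record
        { A-sym   = rankOne-symmetric w b A-sym
        ; P-sym   = rankOne-symmetric a κ P-sym
        ; commute = λ x → ≋-trans (A′P′ x) (≋-trans (commute x) (≋-sym (P′A′ x)))
        ; APA     = λ x i → begin
            (A′ *ᵥ (P′ *ᵥ (A′ *ᵥ x))) i
              ≈⟨ A′P′ (A′ *ᵥ x) i ⟩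
            (A *ᵥ (P *ᵥ (A′ *ᵥ x))) i
              ≈⟨ *ᵥ-congˡ A (≋-trans (*ᵥ-congˡ P (A′x x)) (*ᵥ-linear P (A *ᵥ x) (w * (b · x)) b)) i ⟩
            (A *ᵥ (λ k → (P *ᵥ (A *ᵥ x)) k + w * (b · x) * κ k)) i
              ≈⟨ *ᵥ-linear A (P *ᵥ (A *ᵥ x)) (w * (b · x)) κ i ⟩
            (A *ᵥ (P *ᵥ (A *ᵥ x))) i + w * (b · x) * (A *ᵥ κ) i
              ≈⟨ +-cong (APA x i) (*-congˡ (APb≈b i)) ⟩
            (A *ᵥ x) i + w * (b · x) * b i
              ≈⟨ A′x x i ⟨
            (A′ *ᵥ x) i ∎
        ; PAP     = λ x i → begin
            (P′ *ᵥ (A′ *ᵥ (P′ *ᵥ x))) i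
              ≈⟨ P′A′ (P′ *ᵥ x) i ⟩
            (P *ᵥ (A *ᵥ (P′ *ᵥ x))) i
              ≈⟨ *ᵥ-congˡ P (≋-trans (*ᵥ-congˡ A (P′x x)) (*ᵥ-linear A (P *ᵥ x) (a * (κ · x)) κ)) i ⟩
            (P *ᵥ (λ k → (A *ᵥ (P *ᵥ x)) k + a * (κ · x) * (A *ᵥ κ) k)) i
              ≈⟨ *ᵥ-linear P (A *ᵥ (P *ᵥ x)) (a * (κ · x)) (A *ᵥ κ) i ⟩
            (P *ᵥ (A *ᵥ (P *ᵥ x))) i + a * (κ · x) * (P *ᵥ (A *ᵥ κ)) i
              ≈⟨ +-cong (PAP x i) (*-congˡ (PAP b i)) ⟩
            (P *ᵥ x) i + a * (κ · x) * κ i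
              ≈⟨ P′x x i ⟨
            (P′ *ᵥ x) i ∎
        }

    -- b outside the range of A: z is the multiple of the component of b in
    -- the kernel of A for which b · z ≈ -1
    module OutOfRange (z : Vec n) (β : Carrier)
                      (Az≈0 : ∀ i → (A *ᵥ z) i ≈ 0#) (Pz≈0 : ∀ i → (P *ᵥ z) i ≈ 0#)
                      (bz+1≈0 : b · z + 1# ≈ 0#) (βzz≈1 : β * (z · z) ≈ 1#)
                      (APb≈b+βz : A *ᵥ κ ≋ (λ i → b i + β * z i)) where

      w⁻¹ : Carrier
      w⁻¹ = recip w 0<w

      t : Carrier
      t = w⁻¹ + s

      wt≈1+ws : w * t ≈ 1# + w * s
      wt≈1+ws = trans (distribˡ w w⁻¹ s) (+-congʳ (recip-inverse w 0<w))

      P₁ P₂ P′ : Matrix n n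
      P₁ = rankOne P 1# κ z
      P₂ = rankOne P₁ 1# z κ
      P′ = rankOne P₂ t z z

      P′x : ∀ x → P′ *ᵥ x ≋ (λ i → (P *ᵥ x) i + (z · x) * κ i + (κ · x + t * (z · x)) * z i)
      P′x x i = begin
        (P′ *ᵥ x) i
          ≈⟨ rankOne-*ᵥ P₂ t z z x i ⟩
        (P₂ *ᵥ x) i + t * (z · x) * z i
          ≈⟨ +-congʳ (trans (rankOne-*ᵥ P₁ 1# z κ x i) (+-congʳ (rankOne-*ᵥ P 1# κ z x i))) ⟩
        (P *ᵥ x) i + 1# * (z · x) * κ i + 1# * (κ · x) * z i + t * (z · x) * z i
          ≈⟨ solve 6 (λ y p k q z t → y :+ con 1 :* p :* k :+ con 1 :* q :* z :+ t :* p :* z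
                       := y :+ p :* k :+ (q :+ t :* p) :* z) refl _ (z · x) (κ i) (κ · x) (z i) t ⟩
        (P *ᵥ x) i + (z · x) * κ i + (κ · x + t * (z · x)) * z i ∎

      ·P′x : ∀ y x → y · (P′ *ᵥ x) ≈ y · (P *ᵥ x) + (z · x) * (y · κ) + (κ · x + t * (z · x)) * (y · z)
      ·P′x y x = trans (·-congˡ y (P′x x))
        (trans (·-linearʳ y (λ i → (P *ᵥ x) i + (z · x) * κ i) (κ · x + t * (z · x)) z)
               (+-congʳ (·-linearʳ y (P *ᵥ x) (z · x) κ)))

      vanish : ∀ {x y} → y ≈ 0# → x + y ≈ x
      vanish p = trans (+-congˡ p) (+-identityʳ _)

      vanish-* : ∀ {x y r} → y ≈ 0# → x + r * y ≈ x
      vanish-* p = vanish (trans (*-congˡ p) (zeroʳ _))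

      zA≈0 : ∀ x → z · (A *ᵥ x) ≈ 0#
      zA≈0 x = trans (selfAdjoint A-sym z x) (trans (·-comm (A *ᵥ z) x) (·-zeroʳ x Az≈0))

      zP≈0 : ∀ x → z · (P *ᵥ x) ≈ 0#
      zP≈0 x = trans (selfAdjoint P-sym z x) (trans (·-comm (P *ᵥ z) x) (·-zeroʳ x Pz≈0))

      κA : ∀ x → κ · (A *ᵥ x) ≈ b · x + β * (z · x)
      κA x = trans (selfAdjoint A-sym κ x) (trans (·-congʳ x APb≈b+βz) (·-linearˡ b β z x))

      AP′ : ∀ x → A *ᵥ (P′ *ᵥ x) ≋ (λ i → (A *ᵥ (P *ᵥ x)) i + (z · x) * (A *ᵥ κ) i)
      AP′ x i = trans (·P′x (A i) x) (vanish-* (Az≈0 i))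

      A′P′ : ∀ x → A′ *ᵥ (P′ *ᵥ x) ≋ (λ i → (A *ᵥ (P *ᵥ x)) i + β * (z · x) * z i)
      A′P′ x i = begin
        (A′ *ᵥ (P′ *ᵥ x)) i
          ≈⟨ A′x (P′ *ᵥ x) i ⟩
        (A *ᵥ (P′ *ᵥ x)) i + w * (b · (P′ *ᵥ x)) * b i
          ≈⟨ +-cong (trans (AP′ x i) (+-congˡ (*-congˡ (APb≈b+βz i))))
                    (*-congʳ (*-congˡ (trans (·P′x b x) (+-congʳ (+-congʳ (bP≈κ x)))))) ⟩
        y + p * (b i + β * z i) + w * (q + p * s + (q + t * p) * bz) * b i
          ≈⟨ solve 10 (λ y p bi β zi w q s t bz →
               y :+ p :* (bi :+ β :* zi) :+ w :* (q :+ p :* s :+ (q :+ t :* p) :* bz) :* bi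
               := y :+ β :* p :* zi :+ (w :* q :* (bz :+ con 1) :+ p :* (con 1 :+ w :* s) :+ (w :* t) :* p :* bz) :* bi)
               refl y p (b i) β (z i) w q s t bz ⟩
        y + β * p * z i + (w * q * (bz + 1#) + p * (1# + w * s) + (w * t) * p * bz) * b i
          ≈⟨ +-congˡ (*-congʳ (+-congˡ (*-congʳ (*-congʳ wt≈1+ws)))) ⟩
        y + β * p * z i + (w * q * (bz + 1#) + p * (1# + w * s) + (1# + w * s) * p * bz) * b i
          ≈⟨ +-congˡ (solve 6 (λ w q bz p s bi →
               (w :* q :* (bz :+ con 1) :+ p :* (con 1 :+ w :* s) :+ (con 1 :+ w :* s) :* p :* bz) :* bi
               := (w :* q :+ p :* (con 1 :+ w :* s)) :* bi :* (bz :+ con 1)) refl w q bz p s (b i)) ⟩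
        y + β * p * z i + (w * q + p * (1# + w * s)) * b i * (bz + 1#)
          ≈⟨ vanish-* bz+1≈0 ⟩
        y + β * p * z i ∎
        where
        y  = (A *ᵥ (P *ᵥ x)) i
        p  = z · x
        q  = κ · x
        bz = b · z

      z·A′x : ∀ x → z · (A′ *ᵥ x) ≈ w * (b · x) * (b · z)
      z·A′x x = begin
        z · (A′ *ᵥ x)
          ≈⟨ ·-congˡ z (A′x x) ⟩
        z · (λ i → (A *ᵥ x) i + w * (b · x) * b i)
          ≈⟨ ·-linearʳ z (A *ᵥ x) (w * (b · x)) b ⟩
        z · (A *ᵥ x) + w * (b · x) * (z · b)
          ≈⟨ +-cong (zA≈0 x) (*-congˡ (·-comm z b)) ⟩
        0# + w * (b · x) * (b · z)
          ≈⟨ +-identityˡ _ ⟩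
        w * (b · x) * (b · z) ∎

      PA′x : ∀ x → P *ᵥ (A′ *ᵥ x) ≋ (λ i → (P *ᵥ (A *ᵥ x)) i + w * (b · x) * κ i)
      PA′x x = ≋-trans (*ᵥ-congˡ P (A′x x)) (*ᵥ-linear P (A *ᵥ x) (w * (b · x)) b)

      P′A′ : ∀ x → P′ *ᵥ (A′ *ᵥ x) ≋ (λ i → (P *ᵥ (A *ᵥ x)) i + β * (z · x) * z i)
      P′A′ x i = begin
        (P′ *ᵥ (A′ *ᵥ x)) i
          ≈⟨ P′x (A′ *ᵥ x) i ⟩
        (P *ᵥ (A′ *ᵥ x)) i + (z · (A′ *ᵥ x)) * κ i + (κ · (A′ *ᵥ x) + t * (z · (A′ *ᵥ x))) * z i
          ≈⟨ +-cong (+-cong (PA′x x i) (*-congʳ (z·A′x x))) (*-congʳ (+-cong κ·A′x (*-congˡ (z·A′x x)))) ⟩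
        y + w * r * κ i + w * r * bz * κ i + (r + β * p + w * r * s + t * (w * r * bz)) * z i
          ≈⟨ solve 10 (λ y w r k bz β p s t zi →
               y :+ w :* r :* k :+ w :* r :* bz :* k :+ (r :+ β :* p :+ w :* r :* s :+ t :* (w :* r :* bz)) :* zi
               := y :+ β :* p :* zi :+ w :* r :* k :* (bz :+ con 1)
                  :+ ((con 1 :+ w :* s) :* r :+ (w :* t) :* r :* bz) :* zi)
               refl y w r (κ i) bz β p s t (z i) ⟩
        y + β * p * z i + w * r * κ i * (bz + 1#) + ((1# + w * s) * r + (w * t) * r * bz) * z i
          ≈⟨ +-cong (vanish-* bz+1≈0) (*-congʳ (+-congˡ (*-congʳ (*-congʳ wt≈1+ws)))) ⟩
        y + β * p * z i + ((1# + w * s) * r + (1# + w * s) * r * bz) * z i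
          ≈⟨ +-congˡ (solve 5 (λ w s r bz zi →
               ((con 1 :+ w :* s) :* r :+ (con 1 :+ w :* s) :* r :* bz) :* zi
               := (con 1 :+ w :* s) :* r :* zi :* (bz :+ con 1)) refl w s r bz (z i)) ⟩
        y + β * p * z i + (1# + w * s) * r * z i * (bz + 1#)
          ≈⟨ vanish-* bz+1≈0 ⟩
        y + β * p * z i ∎
        where
        y  = (P *ᵥ (A *ᵥ x)) i
        p  = z · x
        r  = b · x
        bz = b · z

        κ·A′x : κ · (A′ *ᵥ x) ≈ r + β * p + w * r * s
        κ·A′x = trans (·-congˡ κ (A′x x)) (trans (·-linearʳ κ (A *ᵥ x) (w * r) b)
                  (+-cong (κA x) (*-congˡ (·-comm κ b))))

      updated : SymmetricPseudoinverse A′ P′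
      updated = record
        { A-sym   = rankOne-symmetric w b A-sym
        ; P-sym   = λ i j → +-cong
            (trans (solve 5 (λ m k z k′ z′ → m :+ con 1 :* (k :* z) :+ con 1 :* (z′ :* k′)
                              := m :+ con 1 :* (k′ :* z′) :+ con 1 :* (z :* k)) refl (P j i) (κ j) (z i) (κ i) (z j))
                   (+-congʳ (+-congʳ (P-sym i j))))
            (*-congˡ (*-comm (z j) (z i)))
        ; commute = λ x i → trans (A′P′ x i) (trans (+-congʳ (commute x i)) (sym (P′A′ x i)))
        ; APA     = λ x i → begin
            (A′ *ᵥ (P′ *ᵥ (A′ *ᵥ x))) i
              ≈⟨ A′P′ (A′ *ᵥ x) i ⟩
            (A *ᵥ (P *ᵥ (A′ *ᵥ x))) i + β * (z · (A′ *ᵥ x)) * z i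
              ≈⟨ +-cong
                   (trans (*ᵥ-congˡ A (PA′x x) i)
                   (trans (*ᵥ-linear A (P *ᵥ (A *ᵥ x)) (w * (b · x)) κ i)
                          (+-cong (APA x i) (*-congˡ (APb≈b+βz i)))))
                   (*-congʳ (*-congˡ (z·A′x x))) ⟩
            (A *ᵥ x) i + w * (b · x) * (b i + β * z i) + β * (w * (b · x) * (b · z)) * z i
              ≈⟨ solve 7 (λ y w r bi β zi bz →
                   y :+ w :* r :* (bi :+ β :* zi) :+ β :* (w :* r :* bz) :* zi
                   := y :+ w :* r :* bi :+ w :* r :* β :* zi :* (bz :+ con 1))
                   refl _ w (b · x) (b i) β (z i) (b · z) ⟩
            (A *ᵥ x) i + w * (b · x) * b i + w * (b · x) * β * z i * (b · z + 1#)
              ≈⟨ vanish-* bz+1≈0 ⟩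
            (A *ᵥ x) i + w * (b · x) * b i
              ≈⟨ A′x x i ⟨
            (A′ *ᵥ x) i ∎
        ; PAP     = λ x i → begin
            (P′ *ᵥ (A′ *ᵥ (P′ *ᵥ x))) i
              ≈⟨ P′A′ (P′ *ᵥ x) i ⟩
            (P *ᵥ (A *ᵥ (P′ *ᵥ x))) i + β * (z · (P′ *ᵥ x)) * z i
              ≈⟨ +-cong
                   (trans (*ᵥ-congˡ P (AP′ x) i)
                   (trans (*ᵥ-linear P (A *ᵥ (P *ᵥ x)) (z · x) (A *ᵥ κ) i)
                          (+-cong (PAP x i) (*-congˡ (PAP b i)))))
                   (*-congʳ (*-congˡ (z·P′x x))) ⟩
            (P *ᵥ x) i + (z · x) * κ i + β * ((κ · x + t * (z · x)) * (z · z)) * z i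
              ≈⟨ +-congˡ (solve 4 (λ β m zz zi → β :* (m :* zz) :* zi := m :* zi :* (β :* zz))
                   refl β (κ · x + t * (z · x)) (z · z) (z i)) ⟩
            (P *ᵥ x) i + (z · x) * κ i + (κ · x + t * (z · x)) * z i * (β * (z · z))
              ≈⟨ +-congˡ (trans (*-congˡ βzz≈1) (*-identityʳ _)) ⟩
            (P *ᵥ x) i + (z · x) * κ i + (κ · x + t * (z · x)) * z i
              ≈⟨ P′x x i ⟨
            (P′ *ᵥ x) i ∎
        }
        where
        z·P′x : ∀ x → z · (P′ *ᵥ x) ≈ (κ · x + t * (z · x)) * (z · z)
        z·P′x x = begin
          z · (P′ *ᵥ x)
            ≈⟨ ·P′x z x ⟩
          z · (P *ᵥ x) + (z · x) * (z · κ) + (κ · x + t * (z · x)) * (z · z)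
            ≈⟨ +-congʳ (trans (vanish-* (zP≈0 b)) (zP≈0 x)) ⟩
          0# + (κ · x + t * (z · x)) * (z · z)
            ≈⟨ +-identityˡ _ ⟩
          (κ · x + t * (z · x)) * (z · z) ∎

------------------------------------------------------------------------

module LaplacianInverses {c ℓ₁ ℓ₂} (F : OrderedField c ℓ₁ ℓ₂) where

  open OrderedField F
  open OrderedFieldProperties F
  open RingProperties ring
  open SemiringSum semiring using (sum; sum-cong-≋; ∑-distrib-+; *-distribˡ-sum)
  open NatSolver commutativeSemiring using (solve; _:=_; _:+_; _:*_; con)
  open Matrices F
  open Multigraphs F
  open LinearAlgebra F
  open SetoidReasoning setoid

  1ᴹ-diagonal : ∀ {n} (i : Fin n) → 1ᴹ i i ≈ 1#
  1ᴹ-diagonal i with i ≟ i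
  ... | yes _ = refl
  ... | no ¬p = contradiction ≡.refl ¬p

  1ᴹ-offDiagonal : ∀ {n} {i j : Fin n} → i ≢ j → 1ᴹ i j ≈ 0#
  1ᴹ-offDiagonal {i = i} {j} i≢j with i ≟ j
  ... | yes p = contradiction p i≢j
  ... | no _  = refl

  difference : ∀ {n} → Fin n → Fin n → Vec n
  difference i j k = 1ᴹ i k - 1ᴹ j k

  incidence : ∀ {n} → Edge n → Vec n
  incidence e = difference (end₁ e) (end₂ e)

  ·-difference : ∀ {n} (x : Vec n) i j → x · difference i j ≈ x i - x j
  ·-difference x i j = begin
    x · difference i j
      ≈⟨ ·-congˡ x (λ k → +-congˡ (sym (-1*x≈-x (1ᴹ j k)))) ⟩
    x · (λ k → 1ᴹ i k + - 1# * 1ᴹ j k)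
      ≈⟨ ·-linearʳ x (1ᴹ i) (- 1#) (1ᴹ j) ⟩
    x · 1ᴹ i + - 1# * (x · 1ᴹ j)
      ≈⟨ +-cong (·-1ᴹ x i) (trans (-1*x≈-x _) (-‿cong (·-1ᴹ x j))) ⟩
    x i - x j ∎

  incidence-end₁ : ∀ {n} (e : Edge n) → incidence e (end₁ e) ≈ 1#
  incidence-end₁ e =
    trans (+-cong (1ᴹ-diagonal (end₁ e)) (-‿cong (1ᴹ-offDiagonal (loopless e ∘ ≡.sym)))) (x-0≈x 1#)

  incidence-end₂ : ∀ {n} (e : Edge n) → incidence e (end₂ e) ≈ - 1#
  incidence-end₂ e = trans (+-cong (1ᴹ-offDiagonal (loopless e)) (-‿cong (1ᴹ-diagonal (end₂ e)))) (+-identityˡ _)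

  incidence-other : ∀ {n} (e : Edge n) {k} → end₁ e ≢ k → end₂ e ≢ k → incidence e k ≈ 0#
  incidence-other e p q = trans (+-cong (1ᴹ-offDiagonal p) (-‿cong (1ᴹ-offDiagonal q))) (x-0≈x 0#)

  incidence-product : ∀ {n} (e : Edge n) {i j} → i ≢ j → ¬ Joins i j e → incidence e i * incidence e j ≈ 0#
  incidence-product e {i} {j} i≢j ¬joins = go (end₁ e ≟ i) (end₂ e ≟ i) (end₁ e ≟ j) (end₂ e ≟ j)
    where
    go : Dec (end₁ e ≡ i) → Dec (end₂ e ≡ i) → Dec (end₁ e ≡ j) → Dec (end₂ e ≡ j) →
         incidence e i * incidence e j ≈ 0#
    go (no p)  (no q)  _       _       = trans (*-congʳ (incidence-other e p q)) (zeroˡ _)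
    go _       _       (no p)  (no q)  = trans (*-congˡ (incidence-other e p q)) (zeroʳ _)
    go (yes p) _       (yes q) _       = contradiction (≡.trans (≡.sym p) q) i≢j
    go (yes p) _       (no _)  (yes q) = contradiction (inj₁ (p , q)) ¬joins
    go (no _)  (yes p) (yes q) _       = contradiction (inj₂ (q , p)) ¬joins
    go (no _)  (yes p) (no _)  (yes q) = contradiction (≡.trans (≡.sym p) q) i≢j

  laplacian-offDiagonal : ∀ {n} (e : Edge n) G {i j} → i ≢ j →
    - weightBetween (e ∷ G) i j ≈ - weightBetween G i j + weight e * (incidence e i * incidence e j)
  laplacian-offDiagonal e G {i} {j} i≢j with joins? i j e
  ... | yes joins = begin
    - weightBetween (e ∷ G) i j
      ≡⟨ ≡.cong (λ es → - foldr _+_ 0# (map weight es)) (filter-accept (joins? i j) joins) ⟩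
    - (weight e + weightBetween G i j)
      ≈⟨ -‿+-comm _ _ ⟨
    - weight e + - weightBetween G i j
      ≈⟨ +-comm _ _ ⟩
    - weightBetween G i j + - weight e
      ≈⟨ +-congˡ (trans (*-congˡ (product joins)) (trans (sym (-‿distribʳ-* _ _)) (-‿cong (*-identityʳ _)))) ⟨
    - weightBetween G i j + weight e * (incidence e i * incidence e j) ∎
    where
    product : Joins i j e → incidence e i * incidence e j ≈ - 1#
    product (inj₁ (≡.refl , ≡.refl)) =
      trans (*-cong (incidence-end₁ e) (incidence-end₂ e)) (*-identityˡ _)
    product (inj₂ (≡.refl , ≡.refl)) =
      trans (*-cong (incidence-end₂ e) (incidence-end₁ e)) (*-identityʳ _)
  ... | no ¬joins = begin
    - weightBetween (e ∷ G) i j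
      ≡⟨ ≡.cong (λ es → - foldr _+_ 0# (map weight es)) (filter-reject (joins? i j) ¬joins) ⟩
    - weightBetween G i j
      ≈⟨ trans (+-congˡ (trans (*-congˡ (incidence-product e i≢j ¬joins)) (zeroʳ _))) (+-identityʳ _) ⟨
    - weightBetween G i j + weight e * (incidence e i * incidence e j) ∎

  laplacian-cons : ∀ {n} (e : Edge n) G →
    laplacian (e ∷ G) ≈ᴹ rankOne (laplacian G) (weight e) (incidence e) (incidence e)
  laplacian-cons {n} e G i j with i ≟ j
  ... | no i≢j    = laplacian-offDiagonal e G i≢j
  ... | yes ≡.refl = begin
    - sum (off (e ∷ G))
      ≈⟨ -‿cong (sum-cong-≋ off-cons) ⟩
    - sum (λ k → off G k + w * b i * rest k)
      ≈⟨ -‿cong (trans (∑-distrib-+ (off G) (λ k → w * b i * rest k)) (+-congˡ (sym (*-distribˡ-sum (w * b i) rest)))) ⟩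
    - (sum (off G) + w * b i * sum rest)
      ≈⟨ -‿+-comm _ _ ⟨
    - sum (off G) + - (w * b i * sum rest)
      ≈⟨ +-congˡ (trans (-‿distribʳ-* _ _) (trans (*-congˡ -sum-rest) (*-assoc _ _ _))) ⟩
    - sum (off G) + w * (b i * b i) ∎
    where
    w : Carrier
    w = weight e

    b : Vec n
    b = incidence e

    off : WeightedMultigraph n → Vec n
    off G k = if does (i ≟ k) then 0# else - weightBetween G i k

    rest : Vec n
    rest k = if does (i ≟ k) then 0# else b k

    off-cons : ∀ k → off (e ∷ G) k ≈ off G k + w * b i * rest k
    off-cons k with i ≟ k
    ... | yes _  = sym (trans (+-congˡ (zeroʳ _)) (+-identityʳ _))
    ... | no i≢k = trans (laplacian-offDiagonal e G i≢k) (+-congˡ (sym (*-assoc _ _ _)))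

    b-split : ∀ k → b k ≈ rest k + b i * 1ᴹ i k
    b-split k with i ≟ k
    ... | yes ≡.refl = sym (trans (+-identityˡ _) (*-identityʳ _))
    ... | no _       = sym (trans (+-congˡ (zeroʳ _)) (+-identityʳ _))

    ones : Vec n
    ones _ = 1#

    sum-b : sum rest + b i ≈ 0#
    sum-b = begin
      sum rest + b i
        ≈⟨ +-cong (sum-cong-≋ (λ k → *-identityˡ (rest k))) (trans (*-congˡ (·-1ᴹ ones i)) (*-identityʳ _)) ⟨
      ones · rest + b i * (ones · 1ᴹ i)
        ≈⟨ ·-linearʳ ones rest (b i) (1ᴹ i) ⟨
      ones · (λ k → rest k + b i * 1ᴹ i k)
        ≈⟨ ·-congˡ ones b-split ⟨
      ones · b
        ≈⟨ ·-difference ones (end₁ e) (end₂ e) ⟩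
      1# - 1#
        ≈⟨ -‿inverseʳ 1# ⟩
      0# ∎

    -sum-rest : - sum rest ≈ b i
    -sum-rest = begin
      - sum rest                    ≈⟨ +-identityʳ _ ⟨
      - sum rest + 0#               ≈⟨ +-congˡ sum-b ⟨
      - sum rest + (sum rest + b i) ≈⟨ +-assoc _ _ _ ⟨
      - sum rest + sum rest + b i   ≈⟨ +-congʳ (-‿inverseˡ _) ⟩
      0# + b i                      ≈⟨ +-identityˡ _ ⟩
      b i                           ∎

  laplacian-[] : ∀ {n} (i j : Fin n) → laplacian [] i j ≈ 0#
  laplacian-[] {n} i j with i ≟ j
  ... | no _  = -0#≈0#
  ... | yes _ = trans (-‿cong (trans (sum-cong-≋ (λ k → sym (*-identityˡ (row k)))) (·-zeroʳ (λ _ → 1#) row≈0))) -0#≈0#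
    where
    row : Vec n
    row k = if does (i ≟ k) then 0# else - 0#

    row≈0 : ∀ k → row k ≈ 0#
    row≈0 k with i ≟ k
    ... | yes _ = refl
    ... | no  _ = -0#≈0#

  -- M + α L(G), built up edge by edge
  perturb : ∀ {n} → Matrix n n → Carrier → WeightedMultigraph n → Matrix n n
  perturb M α []      = M
  perturb M α (e ∷ G) = rankOne (perturb M α G) (α * weight e) (incidence e) (incidence e)

  perturb≈ : ∀ {n} (M : Matrix n n) α G → perturb M α G ≈ᴹ M +ᴹ α •ᴹ laplacian G
  perturb≈ M α []      i j = sym (trans (+-congˡ (trans (*-congˡ (laplacian-[] i j)) (zeroʳ α))) (+-identityʳ _))
  perturb≈ M α (e ∷ G) i j = begin
    perturb M α G i j + α * weight e * p
      ≈⟨ +-congʳ (perturb≈ M α G i j) ⟩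
    M i j + α * laplacian G i j + α * weight e * p
      ≈⟨ solve 5 (λ m α l w p → m :+ α :* l :+ α :* w :* p := m :+ α :* (l :+ w :* p)) refl _ α _ (weight e) p ⟩
    M i j + α * (laplacian G i j + weight e * p)
      ≈⟨ +-congˡ (*-congˡ (laplacian-cons e G i j)) ⟨
    M i j + α * laplacian (e ∷ G) i j ∎
    where
    p : Carrier
    p = incidence e i * incidence e j

  perturb-psd : ∀ {n} {M : Matrix n n} {α} → PositiveSemidefinite M → 0# < α →
                ∀ G → PositiveSemidefinite (perturb M α G)
  perturb-psd M-psd 0<α []      = M-psd
  perturb-psd M-psd 0<α (e ∷ G) =
    rankOne-psd (incidence e) (*-positive 0<α (positive e)) (perturb-psd M-psd 0<α G)

  *ᴹ-cong : ∀ {m n p} {A A′ : Matrix m n} {B B′ : Matrix n p} →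
            A ≈ᴹ A′ → B ≈ᴹ B′ → A *ᴹ B ≈ᴹ A′ *ᴹ B′
  *ᴹ-cong p q i j = sum-cong-≋ (λ k → *-cong (p i k) (q k j))

  perturb-inverse : ∀ {n} {α} → 0# < α → (G : WeightedMultigraph n) →
    ∃[ Q ] SymmetricPseudoinverse (perturb 1ᴹ α G) Q × (∀ x → perturb 1ᴹ α G *ᵥ (Q *ᵥ x) ≋ x)
  perturb-inverse 0<α []      = 1ᴹ , 1ᴹ-pseudoinverse , λ x → ≋-trans (1ᴹ-*ᵥ _) (1ᴹ-*ᵥ x)
  perturb-inverse 0<α (e ∷ G) =
    let Q , isPinv , inv = perturb-inverse 0<α G
        open Update isPinv (perturb-psd 1ᴹ-psd 0<α G) (incidence e) (*-positive 0<α (positive e))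
        open InRange (inv (incidence e))
    in P′ , updated , λ x → ≋-trans (A′P′ x) (inv x)

  1+αL-inverse : ∀ {n} α → 0# < α → (G : WeightedMultigraph n) →
                 ∃[ Q ] IsInverse (1ᴹ +ᴹ α •ᴹ laplacian G) Q
  1+αL-inverse α 0<α G =
    let Q , isPinv , inv = perturb-inverse 0<α G
        open SymmetricPseudoinverse isPinv
        A  = perturb 1ᴹ α G
        A≈ = perturb≈ 1ᴹ α G
        AQ : A *ᴹ Q ≈ᴹ 1ᴹ
        AQ = *ᵥ-extensional (λ x → ≋-trans (*ᴹ-*ᵥ A Q x) (≋-trans (inv x) (≋-sym (1ᴹ-*ᵥ x))))
        QA : Q *ᴹ A ≈ᴹ 1ᴹ
        QA = *ᵥ-extensional (λ x → ≋-trans (*ᴹ-*ᵥ Q A x)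
               (≋-trans (≋-sym (commute x)) (≋-trans (inv x) (≋-sym (1ᴹ-*ᵥ x)))))
    in Q
     , (λ i j → trans (*ᴹ-cong {B = Q} (λ k l → sym (A≈ k l)) (λ _ _ → refl) i j) (AQ i j))
     , (λ i j → trans (*ᴹ-cong {A = Q} (λ _ _ → refl) (λ k l → sym (A≈ k l)) i j) (QA i j))

  x-1x≈0 : ∀ x → x + - 1# * x ≈ 0#
  x-1x≈0 x = trans (+-congˡ (-1*x≈-x x)) (-‿inverseʳ x)

  joins-sym : ∀ {n} {i j : Fin n} {e} → Joins i j e → Joins j i e
  joins-sym (inj₁ p) = inj₂ p
  joins-sym (inj₂ p) = inj₁ p

  module Range {n} (G : WeightedMultigraph n) {P : Matrix n n}
    (edges : All (λ e → perturb (λ _ _ → 0#) 1# G *ᵥ (P *ᵥ incidence e) ≋ incidence e) G) where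

    InRange : Vec n → Set ℓ₁
    InRange x = perturb (λ _ _ → 0#) 1# G *ᵥ (P *ᵥ x) ≋ x

    A : Matrix n n
    A = perturb (λ _ _ → 0#) 1# G

    respects : ∀ {x y} → x ≋ y → InRange x → InRange y
    respects x≋y p = ≋-trans (*ᵥ-congˡ A (*ᵥ-congˡ P (≋-sym x≋y))) (≋-trans p x≋y)

    linear : ∀ {x} a {y} → InRange x → InRange y → InRange (λ k → x k + a * y k)
    linear {x} a {y} p q i =
      trans (*ᵥ-congˡ A (*ᵥ-linear P x a y) i)
      (trans (*ᵥ-linear A (P *ᵥ x) a (P *ᵥ y) i) (+-cong (p i) (*-congˡ (q i))))

    zero-InRange : InRange (λ _ → 0#)
    zero-InRange i = ·-zeroʳ (A i) (λ k → ·-zeroʳ (P k) (λ _ → refl))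

    joined : ∀ {i j e} → Joins i j e → InRange (incidence e) → InRange (difference i j)
    joined (inj₁ (≡.refl , ≡.refl)) p = p
    joined {e = e} (inj₂ (≡.refl , ≡.refl)) p = respects flip (linear (- 1#) zero-InRange p)
      where
      flip : (λ k → 0# + - 1# * incidence e k) ≋ difference (end₂ e) (end₁ e)
      flip k = begin
        0# + - 1# * (1ᴹ (end₁ e) k - 1ᴹ (end₂ e) k) ≈⟨ trans (+-identityˡ _) (-1*x≈-x _) ⟩
        - (1ᴹ (end₁ e) k - 1ᴹ (end₂ e) k)           ≈⟨ -‿+-comm _ _ ⟨
        - 1ᴹ (end₁ e) k + - - 1ᴹ (end₂ e) k         ≈⟨ +-comm _ _ ⟩
        - - 1ᴹ (end₂ e) k + - 1ᴹ (end₁ e) k         ≈⟨ +-congʳ (-‿involutive _) ⟩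
        1ᴹ (end₂ e) k - 1ᴹ (end₁ e) k               ∎

    adjacent : ∀ {i j G′} → All (InRange ∘ incidence) G′ → Adjacent G′ i j → InRange (difference i j)
    adjacent {G′ = e ∷ _} (p ∷ _) (here q) = joined {e = e} q p
    adjacent (_ ∷ ps) (there q) = adjacent ps q

    connected : ∀ {i j} → Connected G i j → InRange (difference i j)
    connected {i} ε = respects (λ k → sym (-‿inverseʳ (1ᴹ i k))) zero-InRange
    connected {i} {j} (_◅_ {j = k} a p) = respects telescope (linear 1# (adjacent edges a) (connected p))
      where
      telescope : (λ l → difference i k l + 1# * difference k j l) ≋ difference i j
      telescope l = begin
        x - y + 1# * (y - z) ≈⟨ solve 5 (λ x y z y′ z′ → x :+ y′ :+ con 1 :* (y :+ z′) := x :+ z′ :+ (y :+ y′)) refl x y z (- y) (- z) ⟩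
        x - z + (y - y)      ≈⟨ trans (+-congˡ (-‿inverseʳ y)) (+-identityʳ _) ⟩
        x - z                ∎
        where
        x = 1ᴹ i l
        y = 1ᴹ k l
        z = 1ᴹ j l

  perturb-kernel : ∀ {n} (G : WeightedMultigraph n) x → All (λ e → incidence e · x ≈ 0#) G →
                   ∀ i → (perturb (λ _ _ → 0#) 1# G *ᵥ x) i ≈ 0#
  perturb-kernel []      x []       i = trans (·-comm (λ _ → 0#) x) (·-zeroʳ x (λ _ → refl))
  perturb-kernel (e ∷ G) x (p ∷ ps) i = begin
    (perturb (λ _ _ → 0#) 1# (e ∷ G) *ᵥ x) i
      ≈⟨ rankOne-*ᵥ (perturb (λ _ _ → 0#) 1# G) (1# * weight e) (incidence e) (incidence e) x i ⟩
    (perturb (λ _ _ → 0#) 1# G *ᵥ x) i + 1# * weight e * (incidence e · x) * incidence e i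
      ≈⟨ +-cong (perturb-kernel G x ps i) (trans (*-congʳ (trans (*-congˡ p) (zeroʳ _))) (zeroˡ _)) ⟩
    0# + 0#
      ≈⟨ +-identityʳ 0# ⟩
    0# ∎

  component : ∀ {n} → WeightedMultigraph n → Fin n → Vec n
  component G u k = if does (connected? G u k) then 1# else 0#

  component-edges : ∀ {n} (G : WeightedMultigraph n) u → All (λ e → incidence e · component G u ≈ 0#) G
  component-edges G u = All.tabulate λ {e} e∈G →
    trans (·-comm (incidence e) (component G u))
    (trans (·-difference (component G u) (end₁ e) (end₂ e))
           (equal (Any.map (λ { ≡.refl → inj₁ (≡.refl , ≡.refl) }) e∈G)))
    where
    equal : ∀ {i j} → Adjacent G i j → component G u i - component G u j ≈ 0#
    equal {i} {j} a with connected? G u i | connected? G u j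
    ... | yes _ | yes _ = -‿inverseʳ 1#
    ... | yes p | no ¬q = contradiction (p ◅◅ a ◅ ε) ¬q
    ... | no ¬p | yes q = contradiction (q ◅◅ Any.map (λ {e} → joins-sym {e = e}) a ◅ ε) ¬p
    ... | no  _ | no  _ = x-0≈x 0#

  module Separated {n} (G : WeightedMultigraph n) {P : Matrix n n}
                   (isPinv : SymmetricPseudoinverse (perturb (λ _ _ → 0#) 1# G) P)
                   {u v} (¬conn : ¬ Connected G u v) where

    open SymmetricPseudoinverse isPinv

    A : Matrix n n
    A = perturb (λ _ _ → 0#) 1# G

    b κ r χ : Vec n
    b   = difference u v
    κ   = P *ᵥ b
    r k = b k + - 1# * (A *ᵥ κ) k
    χ   = component G u

    Ar≈0 : ∀ i → (A *ᵥ r) i ≈ 0#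
    Ar≈0 i = begin
      (A *ᵥ r) i                                 ≈⟨ *ᵥ-linear A b (- 1#) (A *ᵥ κ) i ⟩
      (A *ᵥ b) i + - 1# * (A *ᵥ (A *ᵥ κ)) i      ≈⟨ +-congˡ (*-congˡ (trans (*ᵥ-congˡ A (commute b) i) (APA b i))) ⟩
      (A *ᵥ b) i + - 1# * (A *ᵥ b) i             ≈⟨ x-1x≈0 _ ⟩
      0#                                         ∎

    Pr≈0 : ∀ i → (P *ᵥ r) i ≈ 0#
    Pr≈0 i = begin
      (P *ᵥ r) i                                 ≈⟨ *ᵥ-linear P b (- 1#) (A *ᵥ κ) i ⟩
      (P *ᵥ b) i + - 1# * (P *ᵥ (A *ᵥ κ)) i      ≈⟨ +-congˡ (*-congˡ (PAP b i)) ⟩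
      (P *ᵥ b) i + - 1# * (P *ᵥ b) i             ≈⟨ x-1x≈0 _ ⟩
      0#                                         ∎

    χ·b≈1 : χ · b ≈ 1#
    χ·b≈1 = trans (·-difference χ u v) (trans (+-cong χu≈1 (-‿cong χv≈0)) (x-0≈x 1#))
      where
      χu≈1 : χ u ≈ 1#
      χu≈1 with connected? G u u
      ... | yes _ = refl
      ... | no ¬p = contradiction ε ¬p

      χv≈0 : χ v ≈ 0#
      χv≈0 with connected? G u v
      ... | yes p = contradiction p ¬conn
      ... | no _  = refl

    χ·r≈1 : χ · r ≈ 1#
    χ·r≈1 = begin
      χ · r                        ≈⟨ ·-linearʳ χ b (- 1#) (A *ᵥ κ) ⟩
      χ · b + - 1# * (χ · (A *ᵥ κ)) ≈⟨ +-cong χ·b≈1 (*-congˡ χ·Aκ≈0) ⟩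
      1# + - 1# * 0#               ≈⟨ trans (+-congˡ (zeroʳ _)) (+-identityʳ 1#) ⟩
      1#                           ∎
      where
      χ·Aκ≈0 : χ · (A *ᵥ κ) ≈ 0#
      χ·Aκ≈0 = trans (selfAdjoint A-sym χ κ) (trans (·-comm (A *ᵥ χ) κ)
                 (·-zeroʳ κ (perturb-kernel G χ (component-edges G u))))

    β : Carrier
    β = r · r

    0<β : 0# < β
    0<β =
      let k , 0<χr = sum-positive⁻¹ (λ k → χ k * r k) (<-respʳ-≈ (sym χ·r≈1) 0<1)
      in sum-positive (λ k → r k * r k) (λ k → square-nonNegative (r k)) k
           (square-positive (factor-#0 (inj₂ 0<χr)))

    g : Carrier
    g = - recip β 0<β

    β*g≈-1 : β * g ≈ - 1#
    β*g≈-1 = trans (sym (-‿distribʳ-* _ _)) (-‿cong (recip-inverse β 0<β))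

    z : Vec n
    z k = g * r k

    scale-kernel : ∀ (M : Matrix n n) → (∀ i → (M *ᵥ r) i ≈ 0#) → ∀ i → (M *ᵥ z) i ≈ 0#
    scale-kernel M Mr≈0 i = trans (·-scaleʳ (M i) g r) (trans (*-congˡ (Mr≈0 i)) (zeroʳ g))

    r·b≈β : r · b ≈ β
    r·b≈β = begin
      r · b                         ≈⟨ +-identityʳ _ ⟨
      r · b + 0#                    ≈⟨ +-congˡ (trans (*-congˡ r·Aκ≈0) (zeroʳ _)) ⟨
      r · b + - 1# * (r · (A *ᵥ κ)) ≈⟨ ·-linearʳ r b (- 1#) (A *ᵥ κ) ⟨
      r · r                         ∎
      where
      r·Aκ≈0 : r · (A *ᵥ κ) ≈ 0#
      r·Aκ≈0 = trans (selfAdjoint A-sym r κ) (trans (·-comm (A *ᵥ r) κ) (·-zeroʳ κ Ar≈0))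

    b·z+1≈0 : b · z + 1# ≈ 0#
    b·z+1≈0 = trans (+-congʳ b·z≈-1) (-‿inverseˡ 1#)
      where
      b·z≈-1 : b · z ≈ - 1#
      b·z≈-1 = trans (·-scaleʳ b g r) (trans (*-congˡ (trans (·-comm b r) r·b≈β)) (trans (*-comm g β) β*g≈-1))

    βzz≈1 : β * (z · z) ≈ 1#
    βzz≈1 = begin
      β * (z · z)         ≈⟨ *-congˡ (trans (·-scaleʳ z g r) (*-congˡ (trans (·-comm z r) (·-scaleʳ r g r)))) ⟩
      β * (g * (g * β))   ≈⟨ solve 2 (λ β g → β :* (g :* (g :* β)) := (β :* g) :* (β :* g)) refl β g ⟩
      (β * g) * (β * g)   ≈⟨ *-cong β*g≈-1 β*g≈-1 ⟩
      - 1# * - 1#         ≈⟨ -1*x≈-x _ ⟩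
      - - 1#              ≈⟨ -‿involutive 1# ⟩
      1#                  ∎

    Aκ≈b+βz : A *ᵥ κ ≋ (λ i → b i + β * z i)
    Aκ≈b+βz i = sym (begin
      b i + β * (g * r i)
        ≈⟨ +-congˡ (trans (sym (*-assoc _ _ _)) (*-congʳ β*g≈-1)) ⟩
      b i + - 1# * (b i + - 1# * (A *ᵥ κ) i)
        ≈⟨ solve 3 (λ b m y → b :+ m :* (b :+ m :* y) := (b :+ m :* b) :+ (m :* m) :* y) refl (b i) (- 1#) ((A *ᵥ κ) i) ⟩
      (b i + - 1# * b i) + (- 1# * - 1#) * (A *ᵥ κ) i
        ≈⟨ +-cong (x-1x≈0 (b i)) (*-congʳ (trans (-1*x≈-x _) (-‿involutive 1#))) ⟩
      0# + 1# * (A *ᵥ κ) i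
        ≈⟨ trans (+-identityˡ _) (*-identityˡ _) ⟩
      (A *ᵥ κ) i ∎)

  perturb-pseudoinverse : ∀ {n} (G : WeightedMultigraph n) → let A = perturb (λ _ _ → 0#) 1# G in
    ∃[ P ] SymmetricPseudoinverse A P × All (λ e → A *ᵥ (P *ᵥ incidence e) ≋ incidence e) G
  perturb-pseudoinverse []      = (λ _ _ → 0#) , 0ᴹ-pseudoinverse , []
  perturb-pseudoinverse (e ∷ G)
    with perturb-pseudoinverse G | connected? G (end₁ e) (end₂ e)
  ... | P , isPinv , edges | yes conn = P′ , updated , (new ∷ All.map (λ {e′} → old {e′}) edges)
    where
    open Update isPinv (perturb-psd 0ᴹ-psd 0<1 G) (incidence e) (*-positive 0<1 (positive e))
    open InRange (Range.connected G {P} edges conn)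

    new : A′ *ᵥ (P′ *ᵥ incidence e) ≋ incidence e
    new = ≋-trans (A′P′ _) (Range.connected G {P} edges conn)

    old : ∀ {e′} → perturb (λ _ _ → 0#) 1# G *ᵥ (P *ᵥ incidence e′) ≋ incidence e′ →
          A′ *ᵥ (P′ *ᵥ incidence e′) ≋ incidence e′
    old p = ≋-trans (A′P′ _) p
  ... | P , isPinv , edges | no ¬conn = P′ , updated , (new ∷ All.map (λ {e′} → old {e′}) edges)
    where
    open Separated G isPinv ¬conn using (A; z; β; Ar≈0; Pr≈0; scale-kernel; b·z+1≈0; βzz≈1; Aκ≈b+βz; β*g≈-1)
    open Update isPinv (perturb-psd 0ᴹ-psd 0<1 G) (incidence e) (*-positive 0<1 (positive e))
    open OutOfRange z β (scale-kernel A Ar≈0) (scale-kernel P Pr≈0) b·z+1≈0 βzz≈1 Aκ≈b+βz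

    new : A′ *ᵥ (P′ *ᵥ incidence e) ≋ incidence e
    new i = begin
      (A′ *ᵥ (P′ *ᵥ incidence e)) i
        ≈⟨ A′P′ (incidence e) i ⟩
      (A *ᵥ κ) i + β * (z · incidence e) * z i
        ≈⟨ +-cong (Aκ≈b+βz i) (*-congʳ (*-congˡ (·-comm z (incidence e)))) ⟩
      incidence e i + β * z i + β * (incidence e · z) * z i
        ≈⟨ solve 4 (λ b β z q → b :+ β :* z :+ β :* q :* z := b :+ β :* z :* (q :+ con 1)) refl _ β (z i) (incidence e · z) ⟩
      incidence e i + β * z i * (incidence e · z + 1#)
        ≈⟨ vanish-* b·z+1≈0 ⟩
      incidence e i ∎

    old : ∀ {e′} → A *ᵥ (P *ᵥ incidence e′) ≋ incidence e′ →
          A′ *ᵥ (P′ *ᵥ incidence e′) ≋ incidence e′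
    old {e′} p i = begin
      (A′ *ᵥ (P′ *ᵥ incidence e′)) i
        ≈⟨ A′P′ (incidence e′) i ⟩
      (A *ᵥ (P *ᵥ incidence e′)) i + β * (z · incidence e′) * z i
        ≈⟨ +-cong (p i) (*-congʳ (*-congˡ (trans (·-congˡ z (≋-sym p)) (zA≈0 _)))) ⟩
      incidence e′ i + β * 0# * z i
        ≈⟨ vanish (trans (*-congʳ (zeroʳ β)) (zeroˡ _)) ⟩
      incidence e′ i ∎

  laplacian-pseudoinverse : ∀ {n} (G : WeightedMultigraph n) → ∃[ L⁺ ] IsMoorePenroseInverse (laplacian G) L⁺
  laplacian-pseudoinverse {n} G =
    let P , isPinv , _ = perturb-pseudoinverse G
    in P , transport {P = P} A≈ (SymmetricPseudoinverse.isMoorePenroseInverse isPinv)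
    where
    A≈ : perturb (λ _ _ → 0#) 1# G ≈ᴹ laplacian G
    A≈ i j = trans (perturb≈ _ 1# G i j) (trans (+-identityˡ _) (*-identityˡ _))

    transport : ∀ {A B P : Matrix n n} → A ≈ᴹ B → IsMoorePenroseInverse A P → IsMoorePenroseInverse B P
    transport {A} {B} {P} A≈B mp = record
      { AA⁺A≈A   = λ i j → trans (sym (*ᴹ-cong AP≈ A≈B i j)) (trans (AA⁺A≈A i j) (A≈B i j))
      ; A⁺AA⁺≈A⁺ = λ i j → trans (sym (*ᴹ-cong {B = P} PA≈ (λ _ _ → refl) i j)) (A⁺AA⁺≈A⁺ i j)
      ; AA⁺-sym  = λ i j → trans (sym (AP≈ j i)) (trans (AA⁺-sym i j) (AP≈ i j))
      ; A⁺A-sym  = λ i j → trans (sym (PA≈ j i)) (trans (A⁺A-sym i j) (PA≈ i j))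
      }
      where
      open IsMoorePenroseInverse mp
      AP≈ : A *ᴹ P ≈ᴹ B *ᴹ P
      AP≈ = *ᴹ-cong {B = P} A≈B (λ _ _ → refl)
      PA≈ : P *ᴹ A ≈ᴹ P *ᴹ B
      PA≈ = *ᴹ-cong {A = P} (λ _ _ → refl) A≈B

------------------------------------------------------------------------

module Distances {c ℓ₁ ℓ₂} (F : OrderedField c ℓ₁ ℓ₂) where

  open OrderedField F
  open OrderedFieldProperties F
  open Matrices F public
  open Multigraphs F public
  open LaplacianInverses F using (1+αL-inverse; laplacian-pseudoinverse)

  0<2 : 0# < 1# + 1#
  0<2 = +-positive (positive⇒nonNegative 0<1) 0<1

  ½ : Carrier
  ½ = recip (1# + 1#) 0<2

  -- Two-sided inverses and Moore–Penrose inverses are unique, so the lemmas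
  -- forestMatrix-isInverse and laplacian⁺-isMoorePenroseInverse determine these
  -- matrices completely; how the existence proofs construct them is immaterial.

  forestMatrix : ∀ {n} (α : Carrier) → 0# < α → WeightedMultigraph n → Matrix n n
  forestMatrix α α>0 G = proj₁ (1+αL-inverse α α>0 G)

  forestMatrix-isInverse : ∀ {n} (α : Carrier) (α>0 : 0# < α) (G : WeightedMultigraph n) →
    IsInverse (1ᴹ +ᴹ α •ᴹ laplacian G) (forestMatrix α α>0 G)
  forestMatrix-isInverse α α>0 G = proj₂ (1+αL-inverse α α>0 G)

  forestDistance : ∀ {n} (α : Carrier) → 0# < α → WeightedMultigraph n → Fin n → Fin n → Carrier
  forestDistance α α>0 G i j = ½ * (Q i i + Q j j - Q i j - Q j i)
    where Q = forestMatrix α α>0 G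

  laplacian⁺ : ∀ {n} → WeightedMultigraph n → Matrix n n
  laplacian⁺ H = proj₁ (laplacian-pseudoinverse H)

  laplacian⁺-isMoorePenroseInverse : ∀ {n} (H : WeightedMultigraph n) →
    IsMoorePenroseInverse (laplacian H) (laplacian⁺ H)
  laplacian⁺-isMoorePenroseInverse H = proj₂ (laplacian-pseudoinverse H)

  resistanceDistance : ∀ {n} → WeightedMultigraph n → Fin n → Fin n → Carrier ⁺
  resistanceDistance H i j =
    if does (connected? H i j)
    then [ L⁺ i i + L⁺ j j - L⁺ i j - L⁺ j i ]
    else ⊤⁺
    where L⁺ = laplacian⁺ H

  -- The new vertex is zero; vertex i of G becomes suc i.

  scaledEdge : ∀ {n} (α : Carrier) → 0# < α → Edge n → Edge (suc n)
  scaledEdge α α>0 e = record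
    { end₁     = suc (end₁ e)
    ; end₂     = suc (end₂ e)
    ; loopless = λ p → loopless e (suc-injective p)
    ; weight   = α * weight e
    ; positive = *-positive α>0 (positive e)
    }

  spoke : ∀ {n} → Fin n → Edge (suc n)
  spoke i = record
    { end₁     = zero
    ; end₂     = suc i
    ; loopless = λ ()
    ; weight   = 1#
    ; positive = 0<1
    }

  extension : ∀ {n} (α : Carrier) → 0# < α → WeightedMultigraph n → WeightedMultigraph (suc n)
  extension α α>0 G = map (scaledEdge α α>0) G ++ tabulate spoke

{-# OPTIONS --safe #-}
-- Put b = difference (suc i) (suc j), let L′ be the Laplacian of the extension and
-- let y be Q (difference i j) extended by 0 at the new vertex.  Deleting the row and
-- column of the new vertex from L′ leaves 1 + α L, the inverse of Q, and the columns
-- of L′ sum to zero; hence L′ y = b.  Then b · L′⁺ b = y · L′ L′⁺ L′ y = y · b, which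
-- says that the quadratic forms of L′⁺ and Q agree on the two difference vectors.
module Submission where

open import Defs
import Algebra.Properties.Ring as RingProperties
import Algebra.Properties.Semiring.Sum as SemiringSum
import Algebra.Solver.Ring.NaturalCoefficients.Default as NatSolver
open import Data.Fin.Base using (Fin; zero; suc)
open import Data.List.Base using ([]; _∷_; _++_; map; tabulate)
import Data.List.Relation.Unary.Any.Properties as Any
open import Data.Nat.Base using (ℕ; zero; suc)
open import Data.Product.Base using (_,_)
open import Data.Sum.Base using (inj₁; inj₂)
open import Function.Base using (_∘_)
open import Relation.Binary.Construct.Add.Supremum.Equality using (_≈⁺_; [_])
open import Relation.Binary.Construct.Closure.ReflexiveTransitive using (ε; _◅_)
open import Relation.Binary.PropositionalEquality.Core as ≡ using (_≡_)
import Relation.Binary.Reasoning.Setoid as SetoidReasoning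
open import Relation.Nullary.Construct.Add.Supremum using ([_])
open import Relation.Nullary.Decidable.Core using (yes; no)
open import Relation.Nullary.Negation.Core using (contradiction)

module _ {c ℓ₁ ℓ₂} (F : OrderedField c ℓ₁ ℓ₂) where

  open OrderedField F
  open OrderedFieldProperties F
  open Distances F
  open LinearAlgebra F
  open LaplacianInverses F
  open RingProperties ring
  open SemiringSum semiring using (sum; sum-cong-≋)
  open NatSolver commutativeSemiring using (solve; _:=_; _:+_; _:*_)
  open SetoidReasoning setoid

  ones : ∀ {n} → Vec n
  ones _ = 1#

  ones·difference : ∀ {n} (i j : Fin n) → ones · difference i j ≈ 0#
  ones·difference i j = trans (·-difference ones i j) (-‿inverseʳ 1#)

  laplacian-[]-*ᵥ : ∀ {n} (x : Vec n) i → (laplacian [] *ᵥ x) i ≈ 0#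
  laplacian-[]-*ᵥ x i = trans (·-comm (laplacian [] i) x) (·-zeroʳ x (laplacian-[] i))

  laplacian-cons-*ᵥ : ∀ {n} (e : Edge n) G x →
    laplacian (e ∷ G) *ᵥ x ≋ (λ i → (laplacian G *ᵥ x) i + weight e * (incidence e · x) * incidence e i)
  laplacian-cons-*ᵥ e G x =
    ≋-trans (*ᵥ-congʳ x (laplacian-cons e G)) (rankOne-*ᵥ (laplacian G) (weight e) (incidence e) (incidence e) x)

  laplacian-symmetric : ∀ {n} (G : WeightedMultigraph n) → Symmetric (laplacian G)
  laplacian-symmetric []      i j = trans (laplacian-[] j i) (sym (laplacian-[] i j))
  laplacian-symmetric (e ∷ G) i j =
    trans (laplacian-cons e G j i)
    (trans (rankOne-symmetric {A = laplacian G} (weight e) (incidence e) (laplacian-symmetric G) i j)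
           (sym (laplacian-cons e G i j)))

  ones·laplacian : ∀ {n} (G : WeightedMultigraph n) x → ones · (laplacian G *ᵥ x) ≈ 0#
  ones·laplacian []      x = ·-zeroʳ ones (laplacian-[]-*ᵥ x)
  ones·laplacian (e ∷ G) x = begin
    ones · (laplacian (e ∷ G) *ᵥ x)
      ≈⟨ ·-congˡ ones (laplacian-cons-*ᵥ e G x) ⟩
    ones · (λ i → (laplacian G *ᵥ x) i + weight e * (incidence e · x) * incidence e i)
      ≈⟨ ·-linearʳ ones (laplacian G *ᵥ x) (weight e * (incidence e · x)) (incidence e) ⟩
    ones · (laplacian G *ᵥ x) + weight e * (incidence e · x) * (ones · incidence e)
      ≈⟨ +-cong (ones·laplacian G x) (trans (*-congˡ (ones·difference (end₁ e) (end₂ e))) (zeroʳ _)) ⟩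
    0# + 0#
      ≈⟨ +-identityʳ 0# ⟩
    0# ∎

  laplacian-tabulate-*ᵥ : ∀ {m n} (e : Fin m → Edge n) x i →
    (laplacian (tabulate e) *ᵥ x) i ≈ sum (λ l → weight (e l) * (incidence (e l) · x) * incidence (e l) i)
  laplacian-tabulate-*ᵥ {zero}  e x i = laplacian-[]-*ᵥ x i
  laplacian-tabulate-*ᵥ {suc m} e x i =
    trans (laplacian-cons-*ᵥ (e zero) (tabulate (e ∘ suc)) x i)
    (trans (+-congʳ (laplacian-tabulate-*ᵥ (e ∘ suc) x i)) (+-comm _ _))

  laplacian-spokes-*ᵥ : ∀ {n} (x : Vec (suc n)) k →
    (laplacian (tabulate spoke) *ᵥ x) (suc k) ≈ x (suc k) - x zero
  laplacian-spokes-*ᵥ x k = begin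
    (laplacian (tabulate spoke) *ᵥ x) (suc k)
      ≈⟨ laplacian-tabulate-*ᵥ spoke x (suc k) ⟩
    sum (λ l → 1# * (incidence (spoke l) · x) * (0# - 1ᴹ l k))
      ≈⟨ sum-cong-≋ term ⟩
    (λ l → x (suc l) - x zero) · 1ᴹ k
      ≈⟨ ·-1ᴹ (λ l → x (suc l) - x zero) k ⟩
    x (suc k) - x zero ∎
    where
    negate : ∀ a b d → (a - b) * (0# - d) ≈ (b - a) * d
    negate a b d = begin
      (a - b) * (0# - d) ≈⟨ *-congˡ (+-identityˡ _) ⟩
      (a - b) * - d      ≈⟨ -‿distribʳ-* _ _ ⟨
      - ((a - b) * d)    ≈⟨ -‿distribˡ-* _ _ ⟩
      - (a - b) * d      ≈⟨ *-congʳ (-‿+-comm a (- b)) ⟨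
      (- a - - b) * d    ≈⟨ *-congʳ (trans (+-comm _ _) (+-congʳ (-‿involutive b))) ⟩
      (b - a) * d        ∎

    term : ∀ l → 1# * (incidence (spoke l) · x) * (0# - 1ᴹ l k) ≈ (x (suc l) - x zero) * 1ᴹ k l
    term l = begin
      1# * (incidence (spoke l) · x) * (0# - 1ᴹ l k)
        ≈⟨ *-congʳ (trans (*-identityˡ _) (trans (·-comm (incidence (spoke l)) x) (·-difference x zero (suc l)))) ⟩
      (x zero - x (suc l)) * (0# - 1ᴹ l k)
        ≈⟨ negate (x zero) (x (suc l)) (1ᴹ l k) ⟩
      (x (suc l) - x zero) * 1ᴹ l k
        ≈⟨ *-congˡ (1ᴹ-symmetric k l) ⟩
      (x (suc l) - x zero) * 1ᴹ k l ∎

  extendByZero : ∀ {n} → Vec n → Vec (suc n)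
  extendByZero x zero    = 0#
  extendByZero x (suc k) = x k

  module _ (α : Carrier) (α>0 : 0# < α) where

    laplacian-scaled-++-*ᵥ : ∀ {n} (G : WeightedMultigraph n) H x k →
      (laplacian (map (scaledEdge α α>0) G ++ H) *ᵥ x) (suc k) ≈
      (laplacian H *ᵥ x) (suc k) + α * (laplacian G *ᵥ (x ∘ suc)) k
    laplacian-scaled-++-*ᵥ [] H x k =
      sym (trans (+-congˡ (trans (*-congˡ (laplacian-[]-*ᵥ (x ∘ suc) k)) (zeroʳ α))) (+-identityʳ _))
    laplacian-scaled-++-*ᵥ (e ∷ G) H x k = begin
      (laplacian (scaledEdge α α>0 e ∷ map (scaledEdge α α>0) G ++ H) *ᵥ x) (suc k)
        ≈⟨ laplacian-cons-*ᵥ (scaledEdge α α>0 e) (map (scaledEdge α α>0) G ++ H) x (suc k) ⟩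
      (laplacian (map (scaledEdge α α>0) G ++ H) *ᵥ x) (suc k)
        + α * weight e * (incidence (scaledEdge α α>0 e) · x) * incidence e k
        ≈⟨ +-cong (laplacian-scaled-++-*ᵥ G H x k) (*-congʳ (*-congˡ incidence-scaled-·)) ⟩
      (laplacian H *ᵥ x) (suc k) + α * (laplacian G *ᵥ (x ∘ suc)) k
        + α * weight e * (incidence e · (x ∘ suc)) * incidence e k
        ≈⟨ solve 6 (λ h a g w q b → h :+ a :* g :+ a :* w :* q :* b := h :+ a :* (g :+ w :* q :* b))
             refl _ α _ (weight e) _ (incidence e k) ⟩
      (laplacian H *ᵥ x) (suc k)
        + α * ((laplacian G *ᵥ (x ∘ suc)) k + weight e * (incidence e · (x ∘ suc)) * incidence e k)
        ≈⟨ +-congˡ (*-congˡ (laplacian-cons-*ᵥ e G (x ∘ suc) k)) ⟨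
      (laplacian H *ᵥ x) (suc k) + α * (laplacian (e ∷ G) *ᵥ (x ∘ suc)) k ∎
      where
      incidence-scaled-· : incidence (scaledEdge α α>0 e) · x ≈ incidence e · (x ∘ suc)
      incidence-scaled-· = trans (+-congʳ (trans (*-congʳ (x-0≈x 0#)) (zeroˡ _))) (+-identityˡ _)

    laplacian-extension-*ᵥ : ∀ {n} (G : WeightedMultigraph n) x k → x zero ≈ 0# →
      (laplacian (extension α α>0 G) *ᵥ x) (suc k) ≈ ((1ᴹ +ᴹ α •ᴹ laplacian G) *ᵥ (x ∘ suc)) k
    laplacian-extension-*ᵥ G x k x₀≈0 = begin
      (laplacian (extension α α>0 G) *ᵥ x) (suc k)
        ≈⟨ laplacian-scaled-++-*ᵥ G (tabulate spoke) x k ⟩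
      (laplacian (tabulate spoke) *ᵥ x) (suc k) + α * (laplacian G *ᵥ (x ∘ suc)) k
        ≈⟨ +-congʳ (trans (laplacian-spokes-*ᵥ x k) (trans (+-congˡ (-‿cong x₀≈0)) (x-0≈x _))) ⟩
      x (suc k) + α * (laplacian G *ᵥ (x ∘ suc)) k
        ≈⟨ +-congʳ (1ᴹ-*ᵥ (x ∘ suc) k) ⟨
      (1ᴹ *ᵥ (x ∘ suc)) k + α * (laplacian G *ᵥ (x ∘ suc)) k
        ≈⟨ ·-linearˡ (1ᴹ k) α (laplacian G k) (x ∘ suc) ⟨
      ((1ᴹ +ᴹ α •ᴹ laplacian G) *ᵥ (x ∘ suc)) k ∎

    laplacian-extension-solution : ∀ {n} (G : WeightedMultigraph n) {Q} →
      IsInverse (1ᴹ +ᴹ α •ᴹ laplacian G) Q → ∀ i j →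
      laplacian (extension α α>0 G) *ᵥ extendByZero (Q *ᵥ difference i j) ≋ difference (suc i) (suc j)
    laplacian-extension-solution {n} G {Q} (MQ≈1 , _) i j = solution
      where
      M : Matrix n n
      M = 1ᴹ +ᴹ α •ᴹ laplacian G

      b : Vec n
      b = difference i j

      L′y : Vec (suc n)
      L′y = laplacian (extension α α>0 G) *ᵥ extendByZero (Q *ᵥ b)

      solution-suc : ∀ k → L′y (suc k) ≈ b k
      solution-suc k = begin
        L′y (suc k)          ≈⟨ laplacian-extension-*ᵥ G (extendByZero (Q *ᵥ b)) k refl ⟩
        (M *ᵥ (Q *ᵥ b)) k    ≈⟨ *ᴹ-*ᵥ M Q b k ⟨
        ((M *ᴹ Q) *ᵥ b) k    ≈⟨ *ᵥ-congʳ b MQ≈1 k ⟩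
        (1ᴹ *ᵥ b) k          ≈⟨ 1ᴹ-*ᵥ b k ⟩
        b k                  ∎

      solution : L′y ≋ difference (suc i) (suc j)
      solution (suc k) = solution-suc k
      solution zero    = begin
        L′y zero                               ≈⟨ trans (+-identityʳ _) (*-identityˡ _) ⟨
        1# * L′y zero + 0#                     ≈⟨ +-congˡ (ones·difference i j) ⟨
        1# * L′y zero + ones · b               ≈⟨ +-congˡ (·-congˡ ones solution-suc) ⟨
        1# * L′y zero + ones · (L′y ∘ suc)     ≈⟨ ones·laplacian (extension α α>0 G) (extendByZero (Q *ᵥ b)) ⟩
        0#                                     ≈⟨ x-0≈x 0# ⟨
        0# - 0#                                ∎

    extension-connected : ∀ {n} (G : WeightedMultigraph n) i j → Connected (extension α α>0 G) (suc i) (suc j)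
    extension-connected G i j = toSpoke i (inj₂ (≡.refl , ≡.refl)) ◅ toSpoke j (inj₁ (≡.refl , ≡.refl)) ◅ ε
      where
      toSpoke : ∀ k {u v} → Joins u v (spoke k) → Adjacent (extension α α>0 G) u v
      toSpoke k p = Any.++⁺ʳ (map (scaledEdge α α>0) G) (Any.tabulate⁺ k p)

  difference-form : ∀ {n} (M : Matrix n n) i j →
    M i i + M j j - M i j - M j i ≈ (M *ᵥ difference i j) i - (M *ᵥ difference i j) j
  difference-form M i j = begin
    M i i + M j j - M i j - M j i
      ≈⟨ solve 4 (λ a d b c → a :+ d :+ b :+ c := (a :+ b) :+ (c :+ d)) refl (M i i) (M j j) (- M i j) (- M j i) ⟩
    (M i i - M i j) + (- M j i + M j j)
      ≈⟨ +-congˡ (trans (sym (-‿+-comm _ _)) (+-congˡ (-‿involutive _))) ⟨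
    (M i i - M i j) - (M j i - M j j)
      ≈⟨ +-cong (·-difference (M i) i j) (-‿cong (·-difference (M j) i j)) ⟨
    (M *ᵥ difference i j) i - (M *ᵥ difference i j) j ∎

  -- Any solution y of L y = difference u v is a potential of a unit current from u to v.
  pseudoinverse-potential : ∀ {n} {A A⁺ : Matrix n n} {u v} {y : Vec n} → Symmetric A →
    A *ᴹ A⁺ *ᴹ A ≈ᴹ A → A *ᵥ y ≋ difference u v →
    A⁺ u u + A⁺ v v - A⁺ u v - A⁺ v u ≈ y u - y v
  pseudoinverse-potential {A = A} {A⁺} {u} {v} {y} A-sym AA⁺A≈A Ay≈b = begin
    A⁺ u u + A⁺ v v - A⁺ u v - A⁺ v u
      ≈⟨ difference-form A⁺ u v ⟩
    (A⁺ *ᵥ b) u - (A⁺ *ᵥ b) v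
      ≈⟨ ·-difference (A⁺ *ᵥ b) u v ⟨
    (A⁺ *ᵥ b) · b
      ≈⟨ ·-cong (*ᵥ-congˡ A⁺ (≋-sym Ay≈b)) (≋-sym Ay≈b) ⟩
    (A⁺ *ᵥ (A *ᵥ y)) · (A *ᵥ y)
      ≈⟨ selfAdjoint A-sym (A⁺ *ᵥ (A *ᵥ y)) y ⟩
    (A *ᵥ (A⁺ *ᵥ (A *ᵥ y))) · y
      ≈⟨ ·-congʳ y (≋-trans (≋-sym (≋-trans (*ᴹ-*ᵥ (A *ᴹ A⁺) A y) (*ᴹ-*ᵥ A A⁺ (A *ᵥ y)))) (*ᵥ-congʳ y AA⁺A≈A)) ⟩
    (A *ᵥ y) · y
      ≈⟨ trans (·-congʳ y Ay≈b) (·-comm b y) ⟩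
    y · b
      ≈⟨ ·-difference y u v ⟩
    y u - y v ∎
    where
    b : Vec _
    b = difference u v

  resistanceDistance-connected : ∀ {n} (H : WeightedMultigraph n) {u v} → Connected H u v →
    let L⁺ = laplacian⁺ H in
    resistanceDistance H u v ≡ [ L⁺ u u + L⁺ v v - L⁺ u v - L⁺ v u ]
  resistanceDistance-connected H {u} {v} p with connected? H u v
  ... | yes _ = ≡.refl
  ... | no ¬p = contradiction p ¬p

  2*½*x≈x : ∀ x → (1# + 1#) * (½ * x) ≈ x
  2*½*x≈x x = trans (sym (*-assoc _ _ _)) (trans (*-congʳ (recip-inverse (1# + 1#) 0<2)) (*-identityˡ x))

proposition13 : ∀ {c ℓ₁ ℓ₂} (F : OrderedField c ℓ₁ ℓ₂) →
    let open OrderedField F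
        open Distances F
    in (α : Carrier) (α>0 : 0# < α) (n : ℕ) (G : WeightedMultigraph n) (i j : Fin n) →
       _≈⁺_ _≈_ (resistanceDistance (extension α α>0 G) (suc i) (suc j))
                [ (1# + 1#) * forestDistance α α>0 G i j ]
proposition13 F α α>0 n G i j =
  ≡.subst (λ r → _≈⁺_ _≈_ r [ (1# + 1#) * forestDistance α α>0 G i j ])
    (≡.sym (resistanceDistance-connected F H (extension-connected F α α>0 G i j)))
    [ trans (pseudoinverse-potential F {A⁺ = laplacian⁺ H} {suc i} {suc j} {extendByZero F (Q *ᵥ difference i j)}
              (laplacian-symmetric F H) AA⁺A≈A
              (laplacian-extension-solution F α α>0 G (forestMatrix-isInverse α α>0 G) i j))
      (trans (sym (difference-form F Q i j))
             (sym (2*½*x≈x F _))) ]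
  where
  open OrderedField F
  open Distances F
  open LinearAlgebra F using (_*ᵥ_)
  open LaplacianInverses F using (difference)

  H : WeightedMultigraph (suc n)
  H = extension α α>0 G

  Q : Matrix n n
  Q = forestMatrix α α>0 G

  open IsMoorePenroseInverse (laplacian⁺-isMoorePenroseInverse H)
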